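{- Let $q, m \geq 2$ be integers with $\gcd(m, q-1) = 1$. Let $p(x) \in \mathbb{Z}[x]$ be a polynomial of degree $h \geq 3$ with $p(\mathbb{N}) \subset \mathbb{N}$. Then there exist constants $C = C(q,m,p) > 0$ and $N_0 = N_0(q,m,p) \geq 1$ such that for all $g \in \mathbb{Z}$ and all integers $N \geq N_0$, $$\#\{0 \leq n < N : \ s_q(p(n)) \equiv g \bmod m\} \geq C\, N^{4/(3h+1)}.$$ Moreover, for monomials $p(x) = x^h$ with $h \geq 3$, one can take $$N_0 = q^{3(2h+m)}\left(2hq^2(6q)^h\right)^{3h+1}, \qquad C = \left(16\, h\, q^5\, (6q)^h \cdot q^{(24h+12m)/(3h+1)}\right)^{ -1}.$$
   Context: For an integer $q \geq 2$ and a nonnegative integer $n$, $s_q(n)$ denotes the sum of the digits of $n$ in its base-$q$ expansion. $\mathbb{N}$ denotes the set of nonnegative integers. -}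

module Defs where

open import Data.Nat using (ℕ; zero; suc; _+_; _*_; _%_; _/_)
open import Data.Nat.Divisibility using (_∣?_)
open import Data.Integer as ℤ using (ℤ; +_; ∣_∣; _-_)
open import Data.Vec using (Vec; []; _∷_)
open import Data.List using (List; length; filter; upTo)
open import Relation.Nullary using (Dec)

-- base-q digit sum with fuel; each step divides by q ≥ 2, so fuel n+1 suffices for n
digitSumFuel : ℕ → ℕ → ℕ → ℕ
digitSumFuel zero    q         n = 0
digitSumFuel (suc f) q         zero = 0
digitSumFuel (suc f) zero      (suc n) = 0   -- base 0: meaningless, never used (q ≥ 2)
digitSumFuel (suc f) q@(suc _) n@(suc _) = n % q + digitSumFuel f q (n / q)

s : ℕ → ℕ → ℕ
s q n = digitSumFuel (suc n) q n

evalPoly : ∀ {k} → Vec ℤ k → ℤ → ℤ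
evalPoly []       x = + 0
evalPoly (a ∷ as) x = a ℤ.+ x ℤ.* evalPoly as x

CongMod : ℕ → ℕ → ℤ → Set
CongMod m x g = m Data.Nat.Divisibility.∣ ∣ + x - g ∣

congMod? : ∀ m x g → Dec (CongMod m x g)
congMod? m x g = m ∣? ∣ + x - g ∣

count : (q m : ℕ) (g : ℤ) (f : ℕ → ℕ) (N : ℕ) → ℕ
count q m g f N = length (filter (λ n → congMod? m (s q (f n)) g) (upTo N))

{-# OPTIONS --safe #-}
-- Substitute the cubic T(x) = m₃x³ + m₂x² − m₁x + m₀, where m₀, m₂, m₃ ∈ [q^v, q^(v+1)) and
-- 1 ≤ m₁ is smaller by a constant factor. In every power of T, hence in a(T(x)) for
-- a ∈ ℕ[x], all coefficients are nonnegative except that of x¹, which is negative. At x = q^k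
-- with q^k larger than all coefficients, the borrow caused by this one negative coefficient makes
-- the digit sum equal to (q − 1)k plus a constant independent of k. As gcd(m, q − 1) = 1, one of
-- any m consecutive k gives the residue g. The value T(q^k) determines k and all m_i, so
-- that about q^(4v) distinct integers below a constant times q^((3h+1)v) are obtained.
-- A general p is first replaced by a translate p(x + e) with positive coefficients.
module Submission where

open import Defs
open import Data.Nat
open import Data.Nat.Properties
open import Data.Nat.DivMod
open import Data.Nat.GCD using (gcd; gcd-GCD; module Bézout)
open import Data.Nat.Tactic.RingSolver using (solve-∀)
import Data.Integer as ℤ
open import Data.Integer using (ℤ; +_; ∣_∣) renaming (_≤_ to _≤ℤ_)
import Data.Integer.Properties as ℤ
import Data.Integer.DivMod as ℤ
import Data.Integer.Divisibility.Signed as ℤ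
import Data.Integer.Tactic.RingSolver as ℤ-Solver
open import Data.Fin using (Fin; toℕ; remQuot) renaming (combine to pair)
open import Data.Fin.Properties using (toℕ-injective; toℕ<n; combine-remQuot; injective⇒≤)
open import Data.List using (List; length)
open import Data.List.Membership.Propositional using (_∈_)
open import Data.List.Membership.Propositional.Properties using (∈-filter⁺; ∈-upTo⁺)
open import Data.List.Membership.Setoid.Properties using (index-injective)
open import Data.Vec using (Vec; []; _∷_; last; sum; map)
open import Data.Vec.Relation.Unary.All using (All; []; _∷_)
open import Data.Product using (Σ; ∃; ∃₂; _×_; _,_; proj₁; proj₂)
open import Function using (_∘_)
open import Relation.Binary.PropositionalEquality
open import Relation.Binary.Definitions using (tri<; tri≈; tri>)
open import Relation.Nullary using (Dec; ¬_; yes; no; contradiction)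

-- Digit sums

-- With no negative coefficient the digit sum at q^k would stop depending on k once q^k is large.
-- With exactly one, -c₁ at x¹, a block q^k - c₁ appears. Its k digits complement those of c₁ - 1,
-- so its digit sum is (q - 1)k minus a constant. Degree three keeps this shape under powers: each
-- exponent up to 3l other than 1 is a sum of l elements of {0, 2, 3}, so T^l has there a product
-- free of m₁, and small m₁ lets it outweigh the negative products. A quadratic m₂x² - m₁x + m₀
-- fails already at x³ in its square. The exponent 4/(3h+1) compares four parameters of size about
-- q^v with values of size about q^(3k+v), where k is about hv because the coefficients of a(T) have
-- size about q^(hv). Identities with signs are stated over ℕ by moving the negative terms to the
-- other side.

digitSumFuel-zero : ∀ f q → digitSumFuel f q 0 ≡ 0
digitSumFuel-zero zero    q = refl
digitSumFuel-zero (suc f) q = refl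

-- Needed because unfolding `s q n` leaves fuel n for n / q, whereas `s q (n / q)` starts with fuel
-- n / q + 1.
digitSumFuel-irrelevant : ∀ {q} → 2 ≤ q → ∀ f f′ {n} → n ≤ f → n ≤ f′ →
                          digitSumFuel f q n ≡ digitSumFuel f′ q n
digitSumFuel-irrelevant {q} _ f f′ {zero} _ _ =
  trans (digitSumFuel-zero f q) (sym (digitSumFuel-zero f′ q))
digitSumFuel-irrelevant {q@(suc _)} 2≤q (suc f) (suc f′) {n@(suc _)} (s≤s n≤f) (s≤s n≤f′) =
  cong (λ z → n % q + z) (digitSumFuel-irrelevant 2≤q f f′
    (≤-trans n/q≤ n≤f) (≤-trans n/q≤ n≤f′))
  where n/q≤ = s≤s⁻¹ (m/n<m n q 2≤q)

s-step : ∀ {q} .{{_ : NonZero q}} → 2 ≤ q → ∀ n → s q n ≡ n % q + s q (n / q)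
s-step {suc _}   2≤q zero    = refl
s-step {q@(suc _)} 2≤q n@(suc _) = cong (λ z → n % q + z)
  (digitSumFuel-irrelevant 2≤q n (suc (n / q)) (<⇒≤ (m/n<m n q 2≤q)) (n≤1+n (n / q)))

-- Serves twice: for base-q digits, and with base q^k to recover the parameters of a cubic from its
-- value.
digit-unique : ∀ {d d′ q} n n′ → d < q → d′ < q → d + q * n ≡ d′ + q * n′ → d ≡ d′ × n ≡ n′
digit-unique {d} {d′} {suc p} n n′ d<q d′<q eq = d≡d′ ,
  *-cancelˡ-≡ n n′ (suc p) (+-cancelˡ-≡ d _ _ (trans eq (cong (_+ suc p * n′) (sym d≡d′))))
  where
  rem : ∀ {d} n → d < suc p → (d + suc p * n) % suc p ≡ d
  rem {d} n d<q = trans (cong (λ x → (d + x) % suc p) (*-comm (suc p) n))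
                   (trans ([m+kn]%n≡m%n d n (suc p)) (m<n⇒m%n≡m d<q))
  d≡d′ = trans (sym (rem n d<q)) (trans (cong (_% suc p) eq) (rem n′ d′<q))

module _ {q : ℕ} (2≤q : 2 ≤ q) where
  private instance
    q≢0 : NonZero q
    q≢0 = >-nonZero (≤-trans (s≤s z≤n) 2≤q)

  s-cons : ∀ {d} n → d < q → s q (d + q * n) ≡ d + s q n
  s-cons {d} n d<q rewrite s-step 2≤q (d + q * n) = cong₂ (λ x y → x + s q y)
    (proj₁ digits) (proj₂ digits)
    where
    digits = digit-unique ((d + q * n) / q) n (m%n<n (d + q * n) q) d<q
      (trans (cong (λ z → (d + q * n) % q + z) (*-comm q _)) (sym (m≡m%n+[m/n]*n (d + q * n) q)))

  private
    split : ∀ a → a ≡ a % q + q * (a / q)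
    split a = trans (m≡m%n+[m/n]*n a q) (cong (λ z → a % q + z) (*-comm (a / q) q))

    s-split : ∀ a → s q a ≡ a % q + s q (a / q)
    s-split = s-step 2≤q

  -- Concatenation of digit strings: a fills only the k lowest places, so no carry occurs.
  s-+-^-* : ∀ k {a} b → a < q ^ k → s q (a + q ^ k * b) ≡ s q a + s q b
  s-+-^-* zero    {zero} b _ = cong (s q) (+-identityʳ b)
  s-+-^-* zero    {suc a} b (s≤s ())
  s-+-^-* (suc k) {a} b a<q^1+k = begin
    s q (a + q ^ suc k * b)                       ≡⟨ cong (s q) regroup ⟩
    s q (a % q + q * (a / q + q ^ k * b))         ≡⟨ s-cons _ (m%n<n a q) ⟩
    a % q + s q (a / q + q ^ k * b)               ≡⟨ cong (λ z → a % q + z) (s-+-^-* k b a/q<q^k) ⟩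
    a % q + (s q (a / q) + s q b)                 ≡⟨ sym (+-assoc (a % q) _ _) ⟩
    a % q + s q (a / q) + s q b                   ≡⟨ cong (_+ s q b) (sym (s-split a)) ⟩
    s q a + s q b ∎
    where
    open ≡-Reasoning
    reassoc : ∀ r q d p b → r + q * d + q * p * b ≡ r + q * (d + p * b)
    reassoc = solve-∀
    a/q<q^k : a / q < q ^ k
    a/q<q^k = m<n*o⇒m/o<n (subst (a <_) (*-comm q (q ^ k)) a<q^1+k)
    regroup : a + q ^ suc k * b ≡ a % q + q * (a / q + q ^ k * b)
    regroup = trans (cong (_+ q ^ suc k * b) (split a)) (reassoc (a % q) q (a / q) (q ^ k) b)

  -- All k digits of q^k - 1 equal q - 1, so a and b have complementary digits. This is the source
  -- of the term (q - 1)k.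
  s-complement : ∀ k a b → suc (a + b) ≡ q ^ k → s q a + s q b ≡ k * (q ∸ 1)
  s-complement zero    zero zero eq = refl
  s-complement (suc k) a b eq = begin
    s q a + s q b                                     ≡⟨ cong₂ _+_ (s-split a) (s-split b) ⟩
    a % q + s q (a / q) + (b % q + s q (b / q))       ≡⟨ interchange (a % q) _ _ _ ⟩
    (a % q + b % q) + (s q (a / q) + s q (b / q))     ≡⟨ cong₂ _+_ low (s-complement k (a / q) (b / q) high) ⟩
    (q ∸ 1) + k * (q ∸ 1) ∎
    where
    open ≡-Reasoning
    interchange : ∀ a b c d → a + b + (c + d) ≡ a + c + (b + d)
    interchange = solve-∀
    regroup : ∀ q r r′ d d′ → suc (r + q * d + (r′ + q * d′)) ≡ suc (r + r′) + q * (d + d′)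
    regroup = solve-∀
    total : suc (a % q + b % q) + q * (a / q + b / q) ≡ q * q ^ k
    total = trans (sym (regroup q (a % q) (b % q) _ _))
      (trans (cong₂ (λ x y → suc (x + y)) (sym (split a)) (sym (split b))) eq)
    -- The low digits satisfy 0 < 1 + a₀ + b₀ < 2q and q divides 1 + a₀ + b₀.
    carry : ∀ r D Q → 1 ≤ r → r < q + q → r + q * D ≡ q * Q → r ≡ q × suc D ≡ Q
    carry r D Q 1≤r r<2q e with r <? q
    ... | yes r<q = contradiction (proj₁ (digit-unique D Q r<q (≤-trans (s≤s z≤n) 2≤q) e))
                                  (m<n⇒n≢0 1≤r)
    ... | no r≮q = trans (sym (m+[n∸m]≡n q≤r)) (trans (cong (λ z → q + z) (proj₁ both)) (+-identityʳ q)) , proj₂ both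
      where
      q≤r = ≮⇒≥ r≮q
      r∸q<q : r ∸ q < q
      r∸q<q = +-cancelˡ-< q _ _ (subst (_< q + q) (sym (m+[n∸m]≡n q≤r)) r<2q)
      shuffle : ∀ q x D → x + q * suc D ≡ q + x + q * D
      shuffle = solve-∀
      both = digit-unique (suc D) Q r∸q<q (≤-trans (s≤s z≤n) 2≤q)
        (trans (shuffle q (r ∸ q) D) (trans (cong (_+ q * D) (m+[n∸m]≡n q≤r)) e))
    carried = carry (suc (a % q + b % q)) (a / q + b / q) (q ^ k) (s≤s z≤n)
      (subst (_≤ q + q) (cong suc (+-suc _ _)) (+-mono-≤ (m%n<n a q) (m%n<n b q))) total
    low : a % q + b % q ≡ q ∸ 1
    low = cong (_∸ 1) (proj₁ carried)
    high : suc (a / q + b / q) ≡ q ^ k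
    high = proj₂ carried

-- Horner form of a polynomial truncated to n terms. At x = 1 it serves as a plain finite sum.
eval : ℕ → (ℕ → ℕ) → ℕ → ℕ
eval zero    f x = 0
eval (suc n) f x = f 0 + x * eval n (f ∘ suc) x

s-eval : ∀ {q} → 2 ≤ q → ∀ k n (c : ℕ → ℕ) → (∀ i → c i < q ^ k) →
         s q (eval n c (q ^ k)) ≡ eval n (s q ∘ c) 1
s-eval 2≤q k zero    c c<X = refl
s-eval {q} 2≤q k (suc n) c c<X = begin
  s q (c 0 + q ^ k * eval n (c ∘ suc) (q ^ k))   ≡⟨ s-+-^-* 2≤q k _ (c<X 0) ⟩
  s q (c 0) + s q (eval n (c ∘ suc) (q ^ k))
    ≡⟨ cong (λ z → s q (c 0) + z) (s-eval 2≤q k n (c ∘ suc) (c<X ∘ suc)) ⟩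
  s q (c 0) + eval n (s q ∘ c ∘ suc) 1           ≡⟨ cong (λ z → s q (c 0) + z) (sym (+-identityʳ _)) ⟩
  s q (c 0) + (eval n (s q ∘ c ∘ suc) 1 + 0) ∎
  where open ≡-Reasoning

-- Reaching every residue class

-- The borrow: X²c₂ - Xc₁ = X²(c₂ - 1) + X(X - c₁) with X = q^k. The base-X digits of V begin with
-- c₀, X - c₁, c₂ - 1, and X - c₁ is the complement of c₁ - 1 with respect to X - 1.
s-negative-linear-coefficient :
  ∀ {q} → 2 ≤ q → ∀ k n V (c : ℕ → ℕ) → (∀ i → c i < q ^ k) → 1 ≤ c 1 → 1 ≤ c 2 →
  V + q ^ k * c 1 ≡ c 0 + q ^ k * (q ^ k * (c 2 + q ^ k * eval n (λ i → c (3 + i)) (q ^ k))) →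
  s q V + s q (pred (c 1)) ≡
  k * (q ∸ 1) + (s q (c 0) + (s q (pred (c 2)) + eval n (λ i → s q (c (3 + i))) 1))
s-negative-linear-coefficient {q} 2≤q k n V c c<X 1≤c₁ 1≤c₂ eq = begin
  s q V + s q β                                                ≡⟨ cong (λ v → s q v + s q β) V≡ ⟩
  s q (c 0 + X * (w + X * (γ + X * R))) + s q β                ≡⟨ cong (_+ s q β) (s-+-^-* 2≤q k _ (c<X 0)) ⟩
  s q (c 0) + s q (w + X * (γ + X * R)) + s q β
    ≡⟨ cong (λ v → s q (c 0) + v + s q β) (s-+-^-* 2≤q k _ w<X) ⟩
  s q (c 0) + (s q w + s q (γ + X * R)) + s q β
    ≡⟨ cong (λ v → s q (c 0) + (s q w + v) + s q β) (s-+-^-* 2≤q k _ γ<X) ⟩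
  s q (c 0) + (s q w + (s q γ + s q R)) + s q β                ≡⟨ gather (s q (c 0)) (s q w) _ (s q β) ⟩
  s q β + s q w + (s q (c 0) + (s q γ + s q R))
    ≡⟨ cong₂ (λ x y → x + (s q (c 0) + (s q γ + y))) (s-complement 2≤q k β w X≡) (s-eval 2≤q k n _ (λ i → c<X (3 + i))) ⟩
  k * (q ∸ 1) + (s q (c 0) + (s q γ + eval n (λ i → s q (c (3 + i))) 1)) ∎
  where
  open ≡-Reasoning
  X = q ^ k
  R = eval n (λ i → c (3 + i)) X
  β = pred (c 1)
  γ = pred (c 2)
  w = X ∸ suc β
  c₁≡ : suc β ≡ c 1
  c₁≡ = suc-pred (c 1) {{>-nonZero 1≤c₁}}
  c₂≡ : suc γ ≡ c 2
  c₂≡ = suc-pred (c 2) {{>-nonZero 1≤c₂}}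
  X≡ : suc β + w ≡ X
  X≡ = m+[n∸m]≡n (subst (_≤ X) (sym c₁≡) (<⇒≤ (c<X 1)))
  w<X : w < X
  w<X = subst (suc w ≤_) X≡ (s≤s (m≤n+m w β))
  γ<X : γ < X
  γ<X = subst (_≤ X) (sym c₂≡) (<⇒≤ (c<X 2))
  gather : ∀ a w b c → a + (w + b) + c ≡ c + w + (a + b)
  gather = solve-∀
  expand : ∀ c₀ X w β γ R → c₀ + X * (w + X * (γ + X * R)) + X * β ≡ c₀ + X * ((β + w) + X * (γ + X * R))
  expand = solve-∀
  factor : ∀ X γ R → X + X * (γ + R) ≡ X * (suc γ + R)
  factor = solve-∀
  V≡ : V ≡ c 0 + X * (w + X * (γ + X * R))
  V≡ = +-cancelʳ-≡ (X * c 1) _ _ (trans eq (sym (begin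
    c 0 + X * (w + X * (γ + X * R)) + X * c 1
      ≡⟨ cong (λ b → c 0 + X * (w + X * (γ + X * R)) + X * b) (sym c₁≡) ⟩
    c 0 + X * (w + X * (γ + X * R)) + X * suc β    ≡⟨ expand (c 0) X w (suc β) γ R ⟩
    c 0 + X * (suc β + w + X * (γ + X * R))        ≡⟨ cong (λ x → c 0 + X * (x + X * (γ + X * R))) X≡ ⟩
    c 0 + X * (X + X * (γ + X * R))                ≡⟨ cong (λ x → c 0 + X * x) (factor X γ (X * R)) ⟩
    c 0 + X * (X * (suc γ + X * R))                ≡⟨ cong (λ g → c 0 + X * (X * (g + X * R))) c₂≡ ⟩
    c 0 + X * (X * (c 2 + X * R)) ∎)))

inverse : ∀ {m p} → gcd m p ≡ 1 → ∃₂ λ v w → v ℤ.* + p ℤ.+ w ℤ.* + m ≡ + 1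
inverse {m} {p} coprime with subst (λ d → Bézout.Identity d m p) coprime (Bézout.identity (gcd-GCD m p))
... | Bézout.+- x y eq = ℤ.- + y , + x , trans (cong (λ z → ℤ.- + y ℤ.* + p ℤ.+ z)
        (trans (sym (ℤ.pos-* x m)) (trans (cong +_ (sym eq)) (trans (ℤ.pos-+ 1 (y * p)) (cong (λ z → + 1 ℤ.+ z) (ℤ.pos-* y p))))))
        (cancel (+ y) (+ p))
  where
  cancel : ∀ y p → ℤ.- y ℤ.* p ℤ.+ (+ 1 ℤ.+ y ℤ.* p) ≡ + 1
  cancel = ℤ-Solver.solve-∀
... | Bézout.-+ x y eq = + y , ℤ.- + x , trans (cong (λ z → z ℤ.+ ℤ.- + x ℤ.* + m)
        (trans (sym (ℤ.pos-* y p)) (trans (cong +_ (sym eq)) (trans (ℤ.pos-+ 1 (x * m)) (cong (λ z → + 1 ℤ.+ z) (ℤ.pos-* x m))))))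
        (cancel (+ x) (+ m))
  where
  cancel : ∀ x m → (+ 1 ℤ.+ x ℤ.* m) ℤ.+ ℤ.- x ℤ.* m ≡ + 1
  cancel = ℤ-Solver.solve-∀

progression-hits-zero : ∀ {m p} .{{_ : NonZero m}} → gcd m p ≡ 1 → ∀ z →
                        ∃ λ j → j < m × (+ m) ℤ.∣ (+ j ℤ.* + p ℤ.+ z)
progression-hits-zero {m} {p} coprime z with inverse {m} {p} coprime
-- With j = -zv - km, jp + z = z(1 - vp) - kmp = (zw - kp)m, which gives the quotient.
... | v , w , vp+wm≡1 = j , ℤ.n%ℕd<d x m , ℤ.divides (z ℤ.* w ℤ.- k ℤ.* + p) (begin
    + j ℤ.* + p ℤ.+ z                                   ≡⟨ cong (λ y → y ℤ.* + p ℤ.+ z) j≡ ⟩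
    (x ℤ.- k ℤ.* + m) ℤ.* + p ℤ.+ z                     ≡⟨ expand z v k (+ m) (+ p) (w) ⟩
    (z ℤ.* w ℤ.- k ℤ.* + p) ℤ.* + m ℤ.+ z ℤ.* (+ 1 ℤ.- (v ℤ.* + p ℤ.+ w ℤ.* + m))
                                                        ≡⟨ cong (λ y → (z ℤ.* w ℤ.- k ℤ.* + p) ℤ.* + m ℤ.+ z ℤ.* (+ 1 ℤ.- y)) vp+wm≡1 ⟩
    (z ℤ.* w ℤ.- k ℤ.* + p) ℤ.* + m ℤ.+ z ℤ.* + 0       ≡⟨ drop _ z ⟩
    (z ℤ.* w ℤ.- k ℤ.* + p) ℤ.* + m ∎)
  where
  open ≡-Reasoning
  x = ℤ.- z ℤ.* v
  j = x ℤ.%ℕ m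
  k = x ℤ./ℕ m
  solve-for : ∀ j k m → j ≡ j ℤ.+ k ℤ.* m ℤ.- k ℤ.* m
  solve-for = ℤ-Solver.solve-∀
  j≡ : + j ≡ x ℤ.- k ℤ.* + m
  j≡ = trans (solve-for (+ j) k (+ m)) (cong (λ y → y ℤ.- k ℤ.* + m) (sym (ℤ.a≡a%ℕn+[a/ℕn]*n x m)))
  expand : ∀ z v k m p w → (ℤ.- z ℤ.* v ℤ.- k ℤ.* m) ℤ.* p ℤ.+ z ≡
           (z ℤ.* w ℤ.- k ℤ.* p) ℤ.* m ℤ.+ z ℤ.* (+ 1 ℤ.- (v ℤ.* p ℤ.+ w ℤ.* m))
  expand = ℤ-Solver.solve-∀
  drop : ∀ a z → a ℤ.+ z ℤ.* + 0 ≡ a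
  drop = ℤ-Solver.solve-∀

-- Over ℤ, S j - g equals jp plus a constant, and p is invertible modulo m.
progression-hits-residue : ∀ {m p} .{{_ : NonZero m}} → gcd m p ≡ 1 → ∀ g K σ M (S : ℕ → ℕ) →
                           (∀ j → S j + σ ≡ (K + j) * p + M) → ∃ λ j → j < m × CongMod m (S j) g
progression-hits-residue {m} {p} coprime g K σ M S S≡ =
  j , proj₁ (proj₂ hit) , ℤ.∣⇒∣ᵤ (subst ((+ m) ℤ.∣_) (sym S-g≡) (proj₂ (proj₂ hit)))
  where
  hit = progression-hits-zero {m} {p} coprime (+ K ℤ.* + p ℤ.+ + M ℤ.- + σ ℤ.- g)
  j = proj₁ hit
  isolate : ∀ S σ g → S ℤ.- g ≡ S ℤ.+ σ ℤ.- σ ℤ.- g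
  isolate = ℤ-Solver.solve-∀
  regroup : ∀ K j p M σ g → (K ℤ.+ j) ℤ.* p ℤ.+ M ℤ.- σ ℤ.- g ≡ j ℤ.* p ℤ.+ (K ℤ.* p ℤ.+ M ℤ.- σ ℤ.- g)
  regroup = ℤ-Solver.solve-∀
  solve-for-S : ∀ S σ K j p M g → S ℤ.+ σ ≡ (K ℤ.+ j) ℤ.* p ℤ.+ M →
                S ℤ.- g ≡ j ℤ.* p ℤ.+ (K ℤ.* p ℤ.+ M ℤ.- σ ℤ.- g)
  solve-for-S S σ K j p M g eq = trans (isolate S σ g)
    (trans (cong (λ y → y ℤ.- σ ℤ.- g) eq) (regroup K j p M σ g))
  S≡ℤ : + S j ℤ.+ + σ ≡ (+ K ℤ.+ + j) ℤ.* + p ℤ.+ + M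
  S≡ℤ = trans (cong +_ (S≡ j)) (cong (λ y → y ℤ.+ + M) (ℤ.pos-* (K + j) p))
  S-g≡ : + S j ℤ.- g ≡ + j ℤ.* + p ℤ.+ (+ K ℤ.* + p ℤ.+ + M ℤ.- + σ ℤ.- g)
  S-g≡ = solve-for-S (+ S j) (+ σ) (+ K) (+ j) (+ p) (+ M) g S≡ℤ

-- Powers of a cubic with one negative coefficient

shift : (ℕ → ℕ) → ℕ → ℕ
shift f zero    = 0
shift f (suc i) = f i

VanishesFrom : ℕ → (ℕ → ℕ) → Set
VanishesFrom n f = ∀ i → n ≤ i → f i ≡ 0

shift-vanishes : ∀ {n f} → VanishesFrom n f → VanishesFrom (suc n) (shift f)
shift-vanishes f≡0 (suc i) (s≤s n≤i) = f≡0 i n≤i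

vanishes-mono : ∀ {n n′ f} → n ≤ n′ → VanishesFrom n f → VanishesFrom n′ f
vanishes-mono n≤n′ f≡0 i n′≤i = f≡0 i (≤-trans n≤n′ n′≤i)

shift-≤ : ∀ {f B} → (∀ i → f i ≤ B) → ∀ i → shift f i ≤ B
shift-≤ f≤ zero    = z≤n
shift-≤ f≤ (suc i) = f≤ i

eval-0 : ∀ n f x → (∀ i → f i ≡ 0) → eval n f x ≡ 0
eval-0 zero    f x f≡0 = refl
eval-0 (suc n) f x f≡0 rewrite f≡0 0 | eval-0 n (f ∘ suc) x (f≡0 ∘ suc) = *-zeroʳ x

eval-suc : ∀ n f x → VanishesFrom n f → eval (suc n) f x ≡ eval n f x
eval-suc zero    f x f≡0 = eval-0 1 f x (λ i → f≡0 i z≤n)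
eval-suc (suc n) f x f≡0 =
  cong (λ y → f 0 + x * y) (eval-suc n (f ∘ suc) x (λ i n≤i → f≡0 (suc i) (s≤s n≤i)))

eval-shift : ∀ n f x → VanishesFrom n (shift f) → eval n (shift f) x ≡ x * eval n f x
-- `eval (suc n) (shift f) x` already computes to `x * eval n f x`; the vanishing hypothesis removes
-- the extra term.
eval-shift n f x vanish = trans (sym (eval-suc n (shift f) x vanish)) refl

eval-+ : ∀ n f g x → eval n (λ i → f i + g i) x ≡ eval n f x + eval n g x
eval-+ zero    f g x = refl
eval-+ (suc n) f g x rewrite eval-+ n (f ∘ suc) (g ∘ suc) x = interchange (f 0) (g 0) x _ _
  where
  interchange : ∀ a b x c d → a + b + x * (c + d) ≡ a + x * c + (b + x * d)
  interchange = solve-∀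

eval-* : ∀ n a f x → eval n (λ i → a * f i) x ≡ a * eval n f x
eval-* zero    a f x = sym (*-zeroʳ a)
eval-* (suc n) a f x rewrite eval-* n a (f ∘ suc) x = factor a (f 0) x _
  where
  factor : ∀ a b x c → a * b + x * (a * c) ≡ a * (b + x * c)
  factor = solve-∀

-- The coefficients of (m₃x³ + m₂x² − m₁x + m₀)^l are pos l i − neg l i.
module CubicPower (m₀ m₁ m₂ m₃ : ℕ) where

  mulPositive : (ℕ → ℕ) → ℕ → ℕ
  mulPositive f i = m₀ * f i + (m₂ * shift (shift f) i + m₃ * shift (shift (shift f)) i)

  -- `pos` collects the products with an even number of factors -m₁x, `neg` those with an odd
  -- number. Multiplying by -m₁x exchanges the two, hence the symmetric recursion.
  pos neg : ℕ → ℕ → ℕ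
  pos zero    zero    = 1
  pos zero    (suc _) = 0
  pos (suc l) i       = mulPositive (pos l) i + m₁ * shift (neg l) i
  neg zero    _       = 0
  neg (suc l) i       = mulPositive (neg l) i + m₁ * shift (pos l) i

  step-vanishes : ∀ {n f g} → VanishesFrom n f → VanishesFrom n g →
                  VanishesFrom (3 + n) (λ i → mulPositive f i + m₁ * shift g i)
  step-vanishes {n} {f} {g} f≡0 g≡0 i 3+n≤i
    rewrite f≡0 i (≤-trans (m≤n+m n 3) 3+n≤i)
          | shift-vanishes (shift-vanishes f≡0) i (≤-trans (n≤1+n _) 3+n≤i)
          | shift-vanishes (shift-vanishes (shift-vanishes f≡0)) i 3+n≤i
          | shift-vanishes g≡0 i (≤-trans (m≤n+m (suc n) 2) 3+n≤i)
          | *-zeroʳ m₀ | *-zeroʳ m₁ | *-zeroʳ m₂ | *-zeroʳ m₃ = refl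

  pos-vanishes : ∀ l → VanishesFrom (1 + l * 3) (pos l)
  neg-vanishes : ∀ l → VanishesFrom (1 + l * 3) (neg l)
  pos-vanishes zero    (suc i) _ = refl
  pos-vanishes (suc l) = step-vanishes {f = pos l} {g = neg l} (pos-vanishes l) (neg-vanishes l)
  neg-vanishes zero    i _ = refl
  neg-vanishes (suc l) = step-vanishes {f = neg l} {g = pos l} (neg-vanishes l) (pos-vanishes l)

  eval-step : ∀ n f g x → VanishesFrom n f → VanishesFrom n g → ∀ N → 3 + n ≤ N →
              eval N (λ i → mulPositive f i + m₁ * shift g i) x ≡
              (m₀ + (m₂ * (x * x) + m₃ * (x * (x * x)))) * eval N f x + m₁ * x * eval N g x
  eval-step n f g x f≡0 g≡0 N 3+n≤N = begin
    eval N (λ i → mulPositive f i + m₁ * shift g i) x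
      ≡⟨ eval-+ N (mulPositive f) (λ i → m₁ * shift g i) x ⟩
    eval N (mulPositive f) x + eval N (λ i → m₁ * shift g i) x
      ≡⟨ cong₂ _+_ (trans (eval-+ N (λ i → m₀ * f i) _ x)
           (cong (λ z → eval N (λ i → m₀ * f i) x + z) (eval-+ N (λ i → m₂ * shift (shift f) i) _ x))) refl ⟩
    eval N (λ i → m₀ * f i) x + (eval N (λ i → m₂ * shift (shift f) i) x +
      eval N (λ i → m₃ * shift (shift (shift f)) i) x) + eval N (λ i → m₁ * shift g i) x
      ≡⟨ cong₂ _+_ (cong₂ _+_ (eval-* N m₀ f x) (cong₂ _+_ (scaled m₂ shift²) (scaled m₃ shift³)))
           (scaled m₁ (eval-shift N g x (vanishes-mono 1+n≤N (shift-vanishes g≡0)))) ⟩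
    m₀ * F + (m₂ * (x * (x * F)) + m₃ * (x * (x * (x * F)))) + m₁ * (x * G)
      ≡⟨ collect m₀ m₁ m₂ m₃ x F G ⟩
    (m₀ + (m₂ * (x * x) + m₃ * (x * (x * x)))) * F + m₁ * x * G ∎
    where
    open ≡-Reasoning
    F = eval N f x
    G = eval N g x
    1+n≤N = ≤-trans (m≤n+m (1 + n) 2) 3+n≤N
    2+n≤N = ≤-trans (m≤n+m (2 + n) 1) 3+n≤N
    scaled : ∀ a {f y} → eval N f x ≡ y → eval N (λ i → a * f i) x ≡ a * y
    scaled a {f} e = trans (eval-* N a f x) (cong (a *_) e)
    shift¹ : eval N (shift f) x ≡ x * F
    shift¹ = eval-shift N f x (vanishes-mono 1+n≤N (shift-vanishes f≡0))
    shift² : eval N (shift (shift f)) x ≡ x * (x * F)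
    shift² = trans (eval-shift N (shift f) x (vanishes-mono 2+n≤N (shift-vanishes (shift-vanishes f≡0)))) (cong (x *_) shift¹)
    shift³ : eval N (shift (shift (shift f))) x ≡ x * (x * (x * F))
    shift³ = trans (eval-shift N (shift (shift f)) x (vanishes-mono 3+n≤N
      (shift-vanishes (shift-vanishes (shift-vanishes f≡0))))) (cong (x *_) shift²)
    collect : ∀ m₀ m₁ m₂ m₃ x F G → m₀ * F + (m₂ * (x * (x * F)) + m₃ * (x * (x * (x * F)))) + m₁ * (x * G) ≡
              (m₀ + (m₂ * (x * x) + m₃ * (x * (x * x)))) * F + m₁ * x * G
    collect = solve-∀

  -- Here t is the value of the cubic. One truncation length N serves all small l, so that the
  -- powers can later be added coefficientwise.
  eval-pos≡^+eval-neg : ∀ {t x} → t + m₁ * x ≡ m₀ + (m₂ * (x * x) + m₃ * (x * (x * x))) →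
                        ∀ l N → 1 + l * 3 ≤ N → eval N (pos l) x ≡ t ^ l + eval N (neg l) x
  eval-pos≡^+eval-neg {t} {x} t≡ zero (suc N) _
    rewrite eval-0 N (λ _ → 0) x (λ _ → refl) = refl
  eval-pos≡^+eval-neg {t} {x} t≡ (suc l) N 4+3l≤N = begin
    eval N (pos (suc l)) x      ≡⟨ eval-step _ (pos l) (neg l) x (pos-vanishes l) (neg-vanishes l) N 4+3l≤N ⟩
    P * eval N (pos l) x + m₁ * x * E   ≡⟨ cong₂ (λ p y → p * y + m₁ * x * E) (sym t≡) ih ⟩
    (t + m₁ * x) * (t ^ l + E) + m₁ * x * E   ≡⟨ rearrange t (m₁ * x) (t ^ l) E ⟩
    t * t ^ l + ((t + m₁ * x) * E + m₁ * x * (t ^ l + E))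
      ≡⟨ cong₂ (λ p y → t * t ^ l + (p * E + m₁ * x * y)) t≡ (sym ih) ⟩
    t * t ^ l + (P * E + m₁ * x * eval N (pos l) x)
      ≡⟨ cong (λ z → t * t ^ l + z) (sym (eval-step _ (neg l) (pos l) x (neg-vanishes l) (pos-vanishes l) N 4+3l≤N)) ⟩
    t * t ^ l + eval N (neg (suc l)) x ∎
    where
    open ≡-Reasoning
    P = m₀ + (m₂ * (x * x) + m₃ * (x * (x * x)))
    E = eval N (neg l) x
    ih = eval-pos≡^+eval-neg t≡ l N (≤-trans (m≤n+m (1 + l * 3) 3) 4+3l≤N)
    rearrange : ∀ t y T E → (t + y) * (T + E) + y * E ≡ t * T + ((t + y) * E + y * (T + E))
    rearrange = solve-∀

  neg-at-0 : ∀ l → neg l 0 ≡ 0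
  neg-at-0 zero    = refl
  neg-at-0 (suc l) rewrite neg-at-0 l | *-zeroʳ m₀ | *-zeroʳ m₁ | *-zeroʳ m₂ | *-zeroʳ m₃ = refl

  -- The exponent 1 is not a sum of elements of {0, 2, 3}; it arises only from a single factor -m₁x
  -- and constants m₀, an odd product.
  pos-at-1 : ∀ l → pos l 1 ≡ 0
  pos-at-1 zero    = refl
  pos-at-1 (suc l) rewrite pos-at-1 l | neg-at-0 l | *-zeroʳ m₀ | *-zeroʳ m₁ | *-zeroʳ m₂ | *-zeroʳ m₃ = refl

  -- The exponents that are sums of l elements of {0, 2, 3}.
  data Dominant (l : ℕ) : ℕ → Set where
    at-0 : Dominant l 0
    from-2 : ∀ {i} → 2 ≤ i → i ≤ l * 3 → Dominant l i

  module Bounds {Q U : ℕ} (Q≤m₀ : Q ≤ m₀) (Q≤m₂ : Q ≤ m₂) (Q≤m₃ : Q ≤ m₃)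
                (m₀≤U : m₀ ≤ U) (m₂≤U : m₂ ≤ U) (m₃≤U : m₃ ≤ U) where

    step-≤ : ∀ {f g F G} → (∀ i → f i ≤ F) → (∀ i → g i ≤ G) →
             ∀ i → mulPositive f i + m₁ * shift g i ≤ (3 * U) * F + m₁ * G
    step-≤ {f} {g} {F} f≤F g≤G i = +-mono-≤
      (≤-trans (+-mono-≤ (*-mono-≤ m₀≤U (f≤F i))
        (+-mono-≤ (*-mono-≤ m₂≤U (shift-≤ (shift-≤ f≤F) i)) (*-mono-≤ m₃≤U (shift-≤ (shift-≤ (shift-≤ f≤F)) i))))
        (≤-reflexive (triple U F)))
      (*-monoʳ-≤ m₁ (shift-≤ g≤G i))
      where
      triple : ∀ U F → U * F + (U * F + U * F) ≡ 3 * U * F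
      triple = solve-∀

    module _ (m₁≤U : m₁ ≤ U) where
      private
        absorb : ∀ F → 3 * U * F + m₁ * F ≤ 4 * U * F
        absorb F = ≤-trans (+-monoʳ-≤ (3 * U * F) (*-monoˡ-≤ F m₁≤U)) (≤-reflexive (quadruple U F))
          where
          quadruple : ∀ U F → 3 * U * F + U * F ≡ 4 * U * F
          quadruple = solve-∀

      pos-≤ : ∀ l i → pos l i ≤ (4 * U) ^ l
      neg-≤ : ∀ l i → neg l i ≤ (4 * U) ^ l
      pos-≤ zero    zero    = ≤-refl
      pos-≤ zero    (suc i) = z≤n
      pos-≤ (suc l) i = ≤-trans (step-≤ (pos-≤ l) (neg-≤ l) i) (absorb _)
      neg-≤ zero    i = z≤n
      neg-≤ (suc l) i = ≤-trans (step-≤ (neg-≤ l) (pos-≤ l) i) (absorb _)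

      -- Each product counted by neg contains a factor m₁, which can sit in any of the l positions.
      4U*neg-≤ : ∀ l i → 4 * U * neg l i ≤ l * m₁ * (4 * U) ^ l
      4U*neg-≤ zero    i rewrite *-zeroʳ (4 * U) = z≤n
      4U*neg-≤ (suc l) i = begin
        W * neg (suc l) i
          ≡⟨ scale W m₀ m₁ m₂ m₃ (neg l i) (shift (shift (neg l)) i) _ (shift (pos l) i) ⟩
        m₀ * (W * neg l i) + (m₂ * (W * shift (shift (neg l)) i) + m₃ * (W * shift (shift (shift (neg l))) i)) +
          m₁ * (W * shift (pos l) i)
          ≤⟨ +-mono-≤ (+-mono-≤ (*-mono-≤ m₀≤U (ih i)) (+-mono-≤ (*-mono-≤ m₂≤U (ih² i)) (*-mono-≤ m₃≤U (ih³ i))))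
                      (*-monoʳ-≤ m₁ (*-monoʳ-≤ W (shift-≤ (pos-≤ l) i))) ⟩
        -- Rounding 3U up to 4U turns the inherited terms into `l * m₁ * W ^ suc l`; the last
        -- summand adds one more `m₁ * W ^ suc l`.
        U * E + (U * E + U * E) + m₁ * (W * W ^ l)       ≤⟨ +-monoˡ-≤ _ (m≤n+m _ (U * E)) ⟩
        U * E + (U * E + (U * E + U * E)) + m₁ * (W * W ^ l)  ≡⟨ collect U l m₁ (W ^ l) ⟩
        suc l * m₁ * (W * W ^ l) ∎
        where
        open ≤-Reasoning
        W = 4 * U
        E = l * m₁ * W ^ l
        ih = 4U*neg-≤ l
        scaled-shift : ∀ {f B} → (∀ i → W * f i ≤ B) → ∀ i → W * shift f i ≤ B
        scaled-shift f≤ zero    = ≤-trans (≤-reflexive (*-zeroʳ W)) z≤n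
        scaled-shift f≤ (suc i) = f≤ i
        ih² = scaled-shift (scaled-shift ih)
        ih³ = scaled-shift ih²
        scale : ∀ W m₀ m₁ m₂ m₃ a b c d → W * (m₀ * a + (m₂ * b + m₃ * c) + m₁ * d) ≡
                m₀ * (W * a) + (m₂ * (W * b) + m₃ * (W * c)) + m₁ * (W * d)
        scale = solve-∀
        collect : ∀ U l m V → U * (l * m * V) + (U * (l * m * V) + (U * (l * m * V) + U * (l * m * V))) + m * (4 * U * V)
                  ≡ (1 + l) * m * (4 * U * V)
        collect = solve-∀

    -- A single product of l factors among m₀, m₂, m₃ with total exponent i already suffices.
    Q^≤pos : ∀ l {i} → Dominant l i → Q ^ l ≤ pos l i
    Q^≤pos zero    at-0 = ≤-refl
    Q^≤pos zero    (from-2 (s≤s _) ())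
    Q^≤pos (suc l) at-0 = m≤n⇒m≤n+o _ (m≤n⇒m≤n+o _ (*-mono-≤ Q≤m₀ (Q^≤pos l at-0)))
    Q^≤pos (suc l) {suc zero} (from-2 (s≤s ()) _)
    Q^≤pos (suc l) {suc (suc zero)} (from-2 _ _) =
      m≤n⇒m≤n+o _ (m≤n⇒m≤o+n (m₀ * pos l 2) (m≤n⇒m≤n+o _ (*-mono-≤ Q≤m₂ (Q^≤pos l at-0))))
    Q^≤pos (suc l) {suc (suc (suc zero))} (from-2 _ _) =
      m≤n⇒m≤n+o _ (m≤n⇒m≤o+n (m₀ * pos l 3) (m≤n⇒m≤o+n (m₂ * pos l 1) (*-mono-≤ Q≤m₃ (Q^≤pos l at-0))))
    Q^≤pos (suc zero) {suc (suc (suc (suc i)))} (from-2 _ (s≤s (s≤s (s≤s ()))))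
    -- Splitting off x³ would leave the unattainable exponent 1, so x² is split off instead.
    Q^≤pos (suc l@(suc _)) {4} (from-2 _ _) =
      m≤n⇒m≤n+o _ (m≤n⇒m≤o+n (m₀ * pos l 4) (m≤n⇒m≤n+o _ (*-mono-≤ Q≤m₂ (Q^≤pos l (from-2 ≤-refl (s≤s (s≤s z≤n)))))))
    Q^≤pos (suc l@(suc _)) {suc (suc (suc i@(suc (suc _))))} (from-2 _ (s≤s (s≤s (s≤s i≤)))) =
      m≤n⇒m≤n+o _ (m≤n⇒m≤o+n (m₀ * pos l (3 + i))
        (m≤n⇒m≤o+n (m₂ * pos l (1 + i)) (*-mono-≤ Q≤m₃ (Q^≤pos l (from-2 (s≤s (s≤s z≤n)) i≤)))))

-- Composition of a polynomial with the cubic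

evalℕ : ∀ {n} → Vec ℕ n → ℕ → ℕ
evalℕ []       x = 0
evalℕ (a ∷ as) x = a + x * evalℕ as x

-- With w l the coefficients of an l-th power, this is coefficient i of the composed polynomial.
-- Arbitrary w allows comparison of `pos`, `neg` and constant bounds.
combine : ∀ {n} → (ℕ → ℕ → ℕ) → ℕ → Vec ℕ n → ℕ → ℕ
combine w l []       i = 0
combine w l (a ∷ as) i = a * w l i + combine w (suc l) as i

combine-const : ∀ {n} B l (as : Vec ℕ n) i → combine (λ _ _ → B) l as i ≡ sum as * B
combine-const B l []       i = refl
combine-const B l (a ∷ as) i =
  trans (cong (λ z → a * B + z) (combine-const B (suc l) as i)) (sym (*-distribʳ-+ B a (sum as)))

module _ {h : ℕ} {w w′ : ℕ → ℕ → ℕ} {i : ℕ} (w≤w′ : ∀ l → l ≤ h → w l i ≤ w′ l i) where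

  combine-mono-≤ : ∀ {n} l (as : Vec ℕ n) → l + n ≤ suc h → combine w l as i ≤ combine w′ l as i
  combine-mono-≤ l []       _ = z≤n
  combine-mono-≤ {suc n} l (a ∷ as) l+n≤ rewrite +-suc l n =
    +-mono-≤ (*-monoʳ-≤ a (w≤w′ l (m+n≤o⇒m≤o l (s≤s⁻¹ l+n≤)))) (combine-mono-≤ (suc l) as l+n≤)

  -- Only the leading coefficient is known to be nonzero, so strictness is asked of the weight h.
  combine-mono-< : ∀ {n} l (as : Vec ℕ (suc n)) → l + n ≡ h → last as ≢ 0 → w h i < w′ h i →
                   combine w l as i < combine w′ l as i
  combine-mono-< l (zero ∷ [])  _    last≢0 _ = contradiction refl last≢0
  combine-mono-< l (suc a ∷ []) refl last≢0 w<w′ rewrite +-identityʳ l =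
    +-monoˡ-< 0 (*-monoʳ-< (suc a) w<w′)
  combine-mono-< {suc n} l (a ∷ b ∷ as) eq last≢0 w<w′ =
    +-mono-≤-< (*-monoʳ-≤ a (w≤w′ l (subst (l ≤_) eq (m≤m+n l (suc n)))))
               (combine-mono-< (suc l) (b ∷ as) (trans (sym (+-suc l n)) eq) last≢0 w<w′)

eval-combine : ∀ {pos neg : ℕ → ℕ → ℕ} {N x t h} →
               (∀ l → l ≤ h → eval N (pos l) x ≡ t ^ l + eval N (neg l) x) →
               ∀ {n} l (as : Vec ℕ n) → l + n ≤ suc h →
               eval N (combine pos l as) x ≡ t ^ l * evalℕ as t + eval N (combine neg l as) x
eval-combine {pos} {neg} {N} {x} {t} eval≡ l [] _
  rewrite eval-0 N (λ _ → 0) x (λ _ → refl) | *-zeroʳ (t ^ l) = refl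
eval-combine {pos} {neg} {N} {x} {t} {h} eval≡ {suc n} l (a ∷ as) l+n≤ = begin
  eval N (combine pos l (a ∷ as)) x
    ≡⟨ trans (eval-+ N (λ i → a * pos l i) _ x) (
           cong₂ _+_ (eval-* N a (pos l) x)
             (eval-combine {pos} {neg} {N} {x} {t} {h} eval≡ (suc l) as 1+l+n≤)) ⟩
  a * eval N (pos l) x + (t * t ^ l * evalℕ as t + eval N (combine neg (suc l) as) x)
    ≡⟨ cong (λ y → a * y + (t * t ^ l * evalℕ as t + eval N (combine neg (suc l) as) x)) (eval≡ l (m+n≤o⇒m≤o l (s≤s⁻¹ 1+l+n≤))) ⟩
  a * (t ^ l + eval N (neg l) x) + (t * t ^ l * evalℕ as t + eval N (combine neg (suc l) as) x)
    ≡⟨ regroup a (t ^ l) _ t (evalℕ as t) _ ⟩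
  t ^ l * (a + t * evalℕ as t) + (a * eval N (neg l) x + eval N (combine neg (suc l) as) x)
    ≡⟨ cong (λ z → t ^ l * (a + t * evalℕ as t) + z) (sym (trans (eval-+ N (λ i → a * neg l i) _ x)
         (cong (_+ eval N (combine neg (suc l) as) x) (eval-* N a (neg l) x)))) ⟩
  t ^ l * (a + t * evalℕ as t) + eval N (combine neg l (a ∷ as)) x ∎
  where
  open ≡-Reasoning
  1+l+n≤ : suc (l + n) ≤ suc h
  1+l+n≤ = subst (_≤ suc h) (+-suc l n) l+n≤
  regroup : ∀ a T E t V F → a * (T + E) + (t * T * V + F) ≡ T * (a + t * V) + (a * E + F)
  regroup = solve-∀

^-distribʳ-* : ∀ n a b → (a * b) ^ n ≡ a ^ n * b ^ n
^-distribʳ-* zero    a b = refl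
^-distribʳ-* (suc n) a b rewrite ^-distribʳ-* n a b = interchange a b (a ^ n) (b ^ n)
  where
  interchange : ∀ a b c d → a * b * (c * d) ≡ a * c * (b * d)
  interchange = solve-∀

-- T(x) with the borrow already carried out: its base-x digits m₀, x - m₁, m₂ - 1, m₃ determine the
-- parameters.
cubic : (m₀ m₁ m₂ m₃ : ℕ) → ℕ → ℕ
cubic m₀ m₁ m₂ m₃ x = m₀ + x * (x ∸ m₁ + x * (pred m₂ + x * m₃))

cubic-spec : ∀ m₀ {m₁ m₂} m₃ {x} → m₁ ≤ x → 1 ≤ m₂ →
             cubic m₀ m₁ m₂ m₃ x + m₁ * x ≡ m₀ + (m₂ * (x * x) + m₃ * (x * (x * x)))
cubic-spec m₀ {m₁} {suc μ} m₃ {x} m₁≤x _ =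
  trans (collect m₀ m₁ (x ∸ m₁) μ m₃ x)
    (trans (cong (λ y → m₀ + x * (y + x * (μ + x * m₃))) (m+[n∸m]≡n m₁≤x)) (expand m₀ μ m₃ x))
  where
  collect : ∀ m₀ m₁ d μ m₃ x → m₀ + x * (d + x * (μ + x * m₃)) + m₁ * x ≡ m₀ + x * (m₁ + d + x * (μ + x * m₃))
  collect = solve-∀
  expand : ∀ m₀ μ m₃ x → m₀ + x * (x + x * (μ + x * m₃)) ≡ m₀ + (suc μ * (x * x) + m₃ * (x * (x * x)))
  expand = solve-∀

-- Digit sums of the composed polynomial at powers of q

module CubicDigits {q Q h : ℕ} (2≤q : 2 ≤ q) (1≤Q : 1 ≤ Q) (1≤h : 1 ≤ h) {m₀ m₁ m₂ m₃ : ℕ}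
  (Q≤m₀ : Q ≤ m₀) (Q≤m₂ : Q ≤ m₂) (Q≤m₃ : Q ≤ m₃)
  (m₀≤U : m₀ ≤ q * Q) (m₂≤U : m₂ ≤ q * Q) (m₃≤U : m₃ ≤ q * Q)
  (1≤m₁ : 1 ≤ m₁) (m₁-small : h * q * (6 * q) ^ h * m₁ ≤ q * Q)
  (as : Vec ℕ (suc h)) (last≢0 : last as ≢ 0) where

  open CubicPower m₀ m₁ m₂ m₃
  open Bounds Q≤m₀ Q≤m₂ Q≤m₃ m₀≤U m₂≤U m₃≤U

  private
    U = q * Q
    1≤q = ≤-trans (s≤s z≤n) 2≤q
    instance
      q≢0 : NonZero q
      q≢0 = >-nonZero 1≤q
      6q≢0 : NonZero (6 * q)
      6q≢0 = m*n≢0 6 q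
      Q≢0 : NonZero Q
      Q≢0 = >-nonZero 1≤Q
    1≤U : 1 ≤ U
    1≤U = *-mono-≤ 1≤q 1≤Q
    instance
      4U≢0 : NonZero (4 * U)
      4U≢0 = m*n≢0 4 U {{_}} {{>-nonZero 1≤U}}

  m₁≤U : m₁ ≤ U
  m₁≤U = ≤-trans (m≤n*m m₁ (h * q * (6 * q) ^ h)
    {{>-nonZero (*-mono-≤ (*-mono-≤ 1≤h 1≤q) (m^n>0 (6 * q) h))}}) m₁-small

  -- One factor m₁ in each negative product costs more than the ratio (4U)^l / Q^l = (4q)^l can
  -- gain; `m₁-small` is made for this.
  neg<pos : ∀ {l i} → l ≤ h → Dominant l i → neg l i < pos l i
  neg<pos {l} {i} l≤h dom = *-cancelˡ-< (4 * U) _ _ (begin-strict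
    4 * U * neg l i                        ≤⟨ 4U*neg-≤ m₁≤U l i ⟩
    l * m₁ * (4 * U) ^ l
      ≡⟨ cong (λ y → l * m₁ * y) (trans (cong (_^ l) (sym (*-assoc 4 q Q))) (^-distribʳ-* l (4 * q) Q)) ⟩
    -- The estimate yields 4q; it is relaxed to 6q, the base in the stated constants.
    l * m₁ * ((4 * q) ^ l * Q ^ l)
      ≤⟨ *-monoʳ-≤ (l * m₁) (*-monoˡ-≤ (Q ^ l) (≤-trans (^-monoˡ-≤ l (*-monoˡ-≤ q (m≤m+n 4 2))) (^-monoʳ-≤ (6 * q) l≤h))) ⟩
    l * m₁ * ((6 * q) ^ h * Q ^ l)         ≤⟨ *-monoˡ-≤ _ (*-monoˡ-≤ m₁ (≤-trans l≤h (m≤m*n h q))) ⟩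
    h * q * m₁ * ((6 * q) ^ h * Q ^ l)     ≡⟨ swap (h * q) m₁ ((6 * q) ^ h) (Q ^ l) ⟩
    h * q * (6 * q) ^ h * m₁ * Q ^ l       ≤⟨ *-monoˡ-≤ (Q ^ l) m₁-small ⟩
    U * Q ^ l
      <⟨ *-monoˡ-< (Q ^ l) {{m^n≢0 Q l}} (m<m+n U (*-mono-≤ {1} {3} (s≤s z≤n) 1≤U)) ⟩
    4 * U * Q ^ l                          ≤⟨ *-monoʳ-≤ (4 * U) (Q^≤pos l dom) ⟩
    4 * U * pos l i ∎)
    where
    open ≤-Reasoning
    swap : ∀ a b c d → a * b * (c * d) ≡ a * c * b * d
    swap = solve-∀

  neg≤pos : ∀ {i} → i ≢ 1 → ∀ l → l ≤ h → neg l i ≤ pos l i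
  neg≤pos {zero}          _   l l≤h = <⇒≤ (neg<pos l≤h at-0)
  neg≤pos {suc zero}      i≢1 l l≤h = contradiction refl i≢1
  neg≤pos {i@(suc (suc _))} _ l l≤h with i ≤? l * 3
  ... | yes i≤3l = <⇒≤ (neg<pos l≤h (from-2 (s≤s (s≤s z≤n)) i≤3l))
  ... | no  i≰3l rewrite neg-vanishes l i (≰⇒> i≰3l) = z≤n

  1≤neg-at-1 : ∀ {l} → 1 ≤ l → 1 ≤ neg l 1
  1≤neg-at-1 {suc l} _ = m≤n⇒m≤o+n (mulPositive (neg l) 1)
    (*-mono-≤ 1≤m₁ (≤-trans (m^n>0 Q l) (Q^≤pos l at-0)))

  private
    p n : ℕ → ℕ
    p = combine pos 0 as
    n = combine neg 0 as

  -- For i ≠ 1 the subtraction does not truncate; for i = 1 the negated coefficient is recorded.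
  coefficient : ℕ → ℕ
  coefficient (suc zero) = n 1
  coefficient i          = p i ∸ n i

  private
    n≤p : ∀ {i} → i ≢ 1 → n i ≤ p i
    n≤p i≢1 = combine-mono-≤ {h} (neg≤pos i≢1) 0 as ≤-refl

    p≤ : ∀ i → p i ≤ sum as * (4 * U) ^ h
    p≤ i = ≤-trans (combine-mono-≤ {h} {w′ = λ _ _ → (4 * U) ^ h}
                     (λ l l≤h → ≤-trans (pos-≤ m₁≤U l i) (^-monoʳ-≤ (4 * U) l≤h)) 0 as ≤-refl)
                   (≤-reflexive (combine-const _ 0 as i))
    n≤ : ∀ i → n i ≤ sum as * (4 * U) ^ h
    n≤ i = ≤-trans (combine-mono-≤ {h} {w′ = λ _ _ → (4 * U) ^ h}
                     (λ l l≤h → ≤-trans (neg-≤ m₁≤U l i) (^-monoʳ-≤ (4 * U) l≤h)) 0 as ≤-refl)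
                   (≤-reflexive (combine-const _ 0 as i))

    p₁≡0 : p 1 ≡ 0
    p₁≡0 = n≤0⇒n≡0 (≤-trans (combine-mono-≤ {h} {w′ = λ _ _ → 0}
                     (λ l _ → ≤-reflexive (pos-at-1 l)) 0 as ≤-refl)
                     (≤-reflexive (trans (combine-const 0 0 as 1) (*-zeroʳ (sum as)))))

  coefficient-≤ : ∀ i → coefficient i ≤ sum as * (4 * U) ^ h
  coefficient-≤ zero          = ≤-trans (m∸n≤m (p 0) (n 0)) (p≤ 0)
  coefficient-≤ (suc zero)    = n≤ 1
  coefficient-≤ i@(suc (suc _)) = ≤-trans (m∸n≤m (p i) (n i)) (p≤ i)

  1≤coefficient-1 : 1 ≤ coefficient 1
  1≤coefficient-1 = subst (_< n 1) (trans (combine-const 0 0 as 1) (*-zeroʳ (sum as)))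
    (combine-mono-< {w = λ _ _ → 0} {w′ = neg} {1} (λ _ _ → z≤n) 0 as refl last≢0 (1≤neg-at-1 1≤h))

  -- The borrow from x² must stop there, which needs a positive coefficient.
  1≤coefficient-2 : 1 ≤ coefficient 2
  1≤coefficient-2 = m<n⇒0<n∸m (combine-mono-< {i = 2} (neg≤pos (λ ())) 0 as refl last≢0
    (neg<pos ≤-refl (from-2 ≤-refl (*-mono-≤ {1} {h} {2} 1≤h (s≤s (s≤s z≤n))))))

  -- The negative parts at exponents other than 1 are added to both sides and cancelled, since there
  -- each truncated subtraction is exact.
  evaluation : ∀ {x} → m₁ ≤ x → evalℕ as (cubic m₀ m₁ m₂ m₃ x) + x * coefficient 1 ≡
               coefficient 0 + x * (x * (coefficient 2 + x * eval (h * 3) (λ i → coefficient (3 + i)) x))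
  evaluation {x} m₁≤x = +-cancelʳ-≡ (n 0 + x * (x * (n 2 + x * Rₙ))) _ _ (begin
    V + x * n 1 + (n 0 + x * (x * (n 2 + x * Rₙ)))     ≡⟨ gather V x (n 0) (n 1) (x * (n 2 + x * Rₙ)) ⟩
    -- The degree is 3h; two extra terms let the first three coefficients split off by computation.
    1 * V + eval (3 + h * 3) n x                       ≡⟨ sym (eval-combine {pos} {neg} {3 + h * 3} {x} {t} {h}
                                                             (λ l l≤h → eval-pos≡^+eval-neg t-spec l (3 + h * 3)
                                                               (≤-trans (s≤s (*-monoˡ-≤ 3 l≤h)) (m≤n+m (1 + h * 3) 2))) 0 as ≤-refl) ⟩
    p 0 + x * (p 1 + x * (p 2 + x * Rₚ))               ≡⟨ cong (λ y → p 0 + x * (y + x * (p 2 + x * Rₚ))) p₁≡0 ⟩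
    p 0 + x * (x * (p 2 + x * Rₚ))
      ≡⟨ cong₂ (λ y z → y + x * (x * z)) (sym (m∸n+n≡m (n≤p (λ ()))))
                                                              (cong₂ (λ y z → y + x * z) (sym (m∸n+n≡m (n≤p {2} (λ ())))) Rₚ≡) ⟩
    (p 0 ∸ n 0 + n 0) + x * (x * ((p 2 ∸ n 2 + n 2) + x * (R + Rₙ)))
      ≡⟨ separate (p 0 ∸ n 0) (n 0) x (p 2 ∸ n 2) (n 2) R Rₙ ⟩
    p 0 ∸ n 0 + x * (x * (p 2 ∸ n 2 + x * R)) + (n 0 + x * (x * (n 2 + x * Rₙ))) ∎)
    where
    open ≡-Reasoning
    t = cubic m₀ m₁ m₂ m₃ x
    t-spec = cubic-spec m₀ m₃ m₁≤x (≤-trans 1≤Q Q≤m₂)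
    V = evalℕ as t
    R = eval (h * 3) (λ i → coefficient (3 + i)) x
    Rₚ = eval (h * 3) (λ i → p (3 + i)) x
    Rₙ = eval (h * 3) (λ i → n (3 + i)) x
    eval-cong : ∀ N {f g : ℕ → ℕ} x → (∀ i → f i ≡ g i) → eval N f x ≡ eval N g x
    eval-cong zero    x f≡g = refl
    eval-cong (suc N) x f≡g = cong₂ (λ y z → y + x * z) (f≡g 0) (eval-cong N x (f≡g ∘ suc))
    Rₚ≡ : Rₚ ≡ R + Rₙ
    Rₚ≡ = trans (eval-cong (h * 3) x (λ i → sym (m∸n+n≡m (n≤p {3 + i} (λ ())))))
                (eval-+ (h * 3) (λ i → coefficient (3 + i)) (λ i → n (3 + i)) x)
    gather : ∀ V x a b y → V + x * b + (a + x * y) ≡ 1 * V + (a + x * (b + y))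
    gather = solve-∀
    separate : ∀ c₀ n₀ x c₂ n₂ R Rₙ → (c₀ + n₀) + x * (x * ((c₂ + n₂) + x * (R + Rₙ))) ≡
               c₀ + x * (x * (c₂ + x * R)) + (n₀ + x * (x * (n₂ + x * Rₙ)))
    separate = solve-∀

  digitDefect digitConstant : ℕ
  digitDefect   = s q (pred (coefficient 1))
  digitConstant = s q (coefficient 0) + (s q (pred (coefficient 2)) +
                    eval (h * 3) (λ i → s q (coefficient (3 + i))) 1)

  s-cubic : ∀ k → sum as * (4 * U) ^ h < q ^ k → U ≤ q ^ k →
            s q (evalℕ as (cubic m₀ m₁ m₂ m₃ (q ^ k))) + digitDefect ≡ k * (q ∸ 1) + digitConstant
  s-cubic k coefficient<X U≤X = s-negative-linear-coefficient 2≤q k (h * 3) _ coefficient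
    (λ i → ≤-<-trans (coefficient-≤ i) coefficient<X) 1≤coefficient-1 1≤coefficient-2
    (evaluation (≤-trans m₁≤U U≤X))

-- Counting

injection⇒≤length : ∀ {M} {xs : List ℕ} (f : Fin M → ℕ) → (∀ {i j} → f i ≡ f j → i ≡ j) →
                    (∀ i → f i ∈ xs) → M ≤ length xs
injection⇒≤length f f-injective f∈ =
  injective⇒≤ (λ {i} {j} eq → f-injective (index-injective (setoid ℕ) (f∈ i) (f∈ j) eq))

≤-count : ∀ {q m g F N M} (f : Fin M → ℕ) → (∀ {i j} → f i ≡ f j → i ≡ j) →
          (∀ i → f i < N) → (∀ i → CongMod m (s q (F (f i))) g) → M ≤ count q m g F N
≤-count {q} {m} {g} {F} f f-injective f<N f≡g = injection⇒≤length f f-injective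
  (λ i → ∈-filter⁺ (λ n → congMod? m (s q (F n)) g) (∈-upTo⁺ (f<N i)) (f≡g i))

remQuot-injective : ∀ {m} n {i j : Fin (m * n)} → remQuot {m} n i ≡ remQuot {m} n j → i ≡ j
remQuot-injective {m} n {i} {j} eq = trans (sym (combine-remQuot {m} n i))
  (trans (cong (λ p → pair (proj₁ p) (proj₂ p)) eq) (combine-remQuot {m} n j))

digit-append-< : ∀ {a x b B} → a < x → b < B → a + x * b < x * B
digit-append-< {a} {x} {b} {B} a<x b<B = begin-strict
  a + x * b   <⟨ +-monoˡ-< (x * b) a<x ⟩
  x + x * b   ≡⟨ sym (*-suc x b) ⟩
  x * suc b   ≤⟨ *-monoʳ-≤ x b<B ⟩
  x * B ∎
  where open ≤-Reasoning

≤-cubic : ∀ m₀ m₁ m₂ {m₃ x b} → b ≤ m₃ → x * (x * (x * b)) ≤ cubic m₀ m₁ m₂ m₃ x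
≤-cubic m₀ m₁ m₂ {m₃} {x} b≤m₃ = m≤n⇒m≤o+n m₀ (*-monoʳ-≤ x (m≤n⇒m≤o+n (x ∸ m₁)
  (*-monoʳ-≤ x (m≤n⇒m≤o+n (pred m₂) (*-monoʳ-≤ x b≤m₃)))))

module _ {m₀ m₁ m₂ m₃ x : ℕ} (m₀<x : m₀ < x)
  (1≤m₁ : 1 ≤ m₁) (m₁≤x : m₁ ≤ x) (1≤m₂ : 1 ≤ m₂) (m₂≤x : m₂ ≤ x) where
  private
    x∸m₁<x : x ∸ m₁ < x
    x∸m₁<x = ∸-monoʳ-< {x} {m₁} {0} 1≤m₁ m₁≤x
    m₂∸1<x : pred m₂ < x
    m₂∸1<x = subst (_≤ x) (sym (suc-pred m₂ {{>-nonZero 1≤m₂}})) m₂≤x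

  cubic-< : ∀ {B} → m₃ < B → cubic m₀ m₁ m₂ m₃ x < x * (x * (x * B))
  cubic-< m₃<B = digit-append-< m₀<x (digit-append-< x∸m₁<x (digit-append-< m₂∸1<x m₃<B))

  -- Successive base-x digits are compared; the ranges of the parameters keep m₀, x - m₁ and m₂ - 1
  -- below x.
  cubic-injective : ∀ {m₀′ m₁′ m₂′ m₃′} → m₀′ < x → 1 ≤ m₁′ → m₁′ ≤ x → 1 ≤ m₂′ → m₂′ ≤ x →
                    cubic m₀ m₁ m₂ m₃ x ≡ cubic m₀′ m₁′ m₂′ m₃′ x →
                    m₀ ≡ m₀′ × m₁ ≡ m₁′ × m₂ ≡ m₂′ × m₃ ≡ m₃′
  cubic-injective {m₀′} {m₁′} {m₂′} {m₃′} m₀′<x 1≤m₁′ m₁′≤x 1≤m₂′ m₂′≤x eq =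
    proj₁ first , ∸-cancelˡ-≡ m₁≤x m₁′≤x (proj₁ second) ,
    pred-injective {{>-nonZero 1≤m₂}} {{>-nonZero 1≤m₂′}} (proj₁ third) , proj₂ third
    where
    first = digit-unique (x ∸ m₁ + x * (pred m₂ + x * m₃)) (x ∸ m₁′ + x * (pred m₂′ + x * m₃′)) m₀<x m₀′<x eq
    second = digit-unique (pred m₂ + x * m₃) (pred m₂′ + x * m₃′) x∸m₁<x (∸-monoʳ-< {x} {m₁′} {0} 1≤m₁′ m₁′≤x) (proj₂ first)
    third = digit-unique m₃ m₃′ m₂∸1<x (subst (_≤ x) (sym (suc-pred m₂′ {{>-nonZero 1≤m₂′}})) m₂′≤x) (proj₂ second)

crossing : (P : ℕ → Set) → (∀ n → Dec (P n)) → P 0 → ∀ b → ¬ P b → ∃ λ u → P u × ¬ P (suc u)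
crossing P P? P0 zero    ¬Pb = contradiction P0 ¬Pb
crossing P P? P0 (suc b) ¬Pb with P? b
... | yes Pb  = b , Pb , ¬Pb
... | no  ¬Pb′ = crossing P P? P0 b ¬Pb′

n<q^n : ∀ {q} → 2 ≤ q → ∀ n → n < q ^ n
n<q^n 2≤q zero    = s≤s z≤n
n<q^n {q} 2≤q (suc n) = begin-strict
  suc n         ≡⟨ +-comm 1 n ⟩
  n + 1         <⟨ +-mono-<-≤ (n<q^n 2≤q n) (≤-trans (s≤s z≤n) (n<q^n 2≤q n)) ⟩
  q ^ n + q ^ n ≡⟨ cong (λ z → q ^ n + z) (sym (+-identityʳ (q ^ n))) ⟩
  2 * q ^ n     ≤⟨ *-monoˡ-≤ (q ^ n) 2≤q ⟩
  q * q ^ n ∎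
  where open ≤-Reasoning

-- The shift e and the size bound r cover both cases at once: monomials take e = r = 0, which
-- preserves the explicit constants.
module Counting {q m h : ℕ} (2≤q : 2 ≤ q) (2≤m : 2 ≤ m) (coprime : gcd m (q ∸ 1) ≡ 1) (1≤h : 1 ≤ h)
  (as : Vec ℕ (suc h)) (last≢0 : last as ≢ 0) (f : ℕ → ℕ) (e : ℕ)
  (f-shift : ∀ n → f (n + e) ≡ evalℕ as n) (r : ℕ) (sum≤ : sum as ≤ q ^ r) where

  private
    1≤q = ≤-trans (s≤s z≤n) 2≤q
    instance
      q≢0 : NonZero q
      q≢0 = >-nonZero 1≤q
      m≢0 : NonZero m
      m≢0 = >-nonZero (≤-trans (s≤s z≤n) 2≤m)

  module _ (v M₁ : ℕ) (M₁-small : h * q * (6 * q) ^ h * M₁ ≤ q ^ suc v) (g : ℤ) where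

    private
      Q U K d : ℕ
      Q = q ^ v
      U = q ^ suc v
      -- From 4 ≤ q² the coefficients are at most q^r (q² U)^h = q^(K - 1), so any exponent from K
      -- on is large enough.
      K = suc ((2 + suc v) * h + r)
      d = (q ∸ 1) * Q

      1≤Q : 1 ≤ Q
      1≤Q = m^n>0 q v

      Q+d≡U : Q + d ≡ U
      Q+d≡U = cong (_* Q) (m+[n∸m]≡n 1≤q)

      u≤K : suc v ≤ K
      u≤K = m≤n⇒m≤1+n (m≤n⇒m≤n+o r (≤-trans (m≤n+m (suc v) 2) (m≤m*n (2 + suc v) h {{>-nonZero 1≤h}})))

      U≤q^K+ : ∀ j → U ≤ q ^ (K + j)
      U≤q^K+ j = ^-monoʳ-≤ q (m≤n⇒m≤n+o j u≤K)

      coefficient<q^K+ : ∀ j → sum as * (4 * U) ^ h < q ^ (K + j)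
      coefficient<q^K+ j = begin-strict
        sum as * (4 * U) ^ h
          ≤⟨ *-mono-≤ sum≤ (^-monoˡ-≤ h (*-monoˡ-≤ U (*-mono-≤ 2≤q (*-mono-≤ 2≤q (≤-refl {1}))))) ⟩
        q ^ r * (q ^ 2 * U) ^ h         ≡⟨ cong (λ y → q ^ r * y ^ h) (sym (^-distribˡ-+-* q 2 (suc v))) ⟩
        q ^ r * (q ^ (2 + suc v)) ^ h   ≡⟨ cong (q ^ r *_) (^-*-assoc q (2 + suc v) h) ⟩
        q ^ r * q ^ ((2 + suc v) * h)   ≡⟨ sym (^-distribˡ-+-* q r _) ⟩
        q ^ (r + (2 + suc v) * h)       <⟨ ^-monoʳ-< q 2≤q (s≤s (≤-trans (≤-reflexive (+-comm r _)) (m≤m+n _ j))) ⟩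
        q ^ (K + j) ∎
        where open ≤-Reasoning

      digit : Fin d → ℕ
      digit i = Q + toℕ i

      Q≤digit : ∀ i → Q ≤ digit i
      Q≤digit i = m≤m+n Q (toℕ i)

      digit<U : ∀ i → digit i < U
      digit<U i = subst (digit i <_) Q+d≡U (+-monoʳ-< Q (toℕ<n i))

      digit≤U : ∀ i → digit i ≤ U
      digit≤U i = <⇒≤ (digit<U i)

      digit-injective : ∀ {i j} → digit i ≡ digit j → i ≡ j
      digit-injective eq = toℕ-injective (+-cancelˡ-≡ Q _ _ eq)

      Index : Set
      Index = Fin d × Fin M₁ × Fin d × Fin d

      unpair : Fin (d * (M₁ * (d * d))) → Index
      unpair x = let (i , y) = remQuot (M₁ * (d * d)) x
                     (j , z) = remQuot (d * d) y in i , j , remQuot d z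

      unpair-injective : ∀ {x y} → unpair x ≡ unpair y → x ≡ y
      unpair-injective eq = remQuot-injective {d} _ (cong₂ _,_ (cong proj₁ eq)
        (remQuot-injective {M₁} _ (cong₂ _,_ (cong (proj₁ ∘ proj₂) eq)
          (remQuot-injective {d} _ (cong (proj₂ ∘ proj₂) eq)))))

      cubicAt : Index → ℕ → ℕ
      cubicAt (i₀ , i₁ , i₂ , i₃) = cubic (digit i₀) (suc (toℕ i₁)) (digit i₂) (digit i₃)

      -- The defect and the constant depend on the parameters but not on j, so j is chosen
      -- separately for each tuple. Injectivity must therefore recover the exponent too.
      good-exponent : ∀ i → ∃ λ j → j < m × CongMod m (s q (evalℕ as (cubicAt i (q ^ (K + j))))) g
      good-exponent (i₀ , i₁ , i₂ , i₃) = progression-hits-residue {m} {q ∸ 1} coprime g K digitDefect digitConstant _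
        (λ j → s-cubic (K + j) (coefficient<q^K+ j) (U≤q^K+ j))
        where
        open CubicDigits 2≤q 1≤Q 1≤h (Q≤digit i₀) (Q≤digit i₂) (Q≤digit i₃)
          (digit≤U i₀) (digit≤U i₂) (digit≤U i₃) (s≤s z≤n)
          (≤-trans (*-monoʳ-≤ (h * q * (6 * q) ^ h) (toℕ<n i₁)) M₁-small) as last≢0

      k : Index → ℕ
      k i = K + proj₁ (good-exponent i)

      value : Index → ℕ
      value i = cubicAt i (q ^ k i)

      U≤q^k : ∀ i → U ≤ q ^ k i
      U≤q^k i = U≤q^K+ (proj₁ (good-exponent i))

      M₁≤U : M₁ ≤ U
      M₁≤U = ≤-trans (m≤n*m M₁ (h * q * (6 * q) ^ h)
        {{>-nonZero (*-mono-≤ (*-mono-≤ 1≤h 1≤q) (m^n>0 (6 * q) {{m*n≢0 6 q}} h))}}) M₁-small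

      value-< : ∀ i → value i < q ^ k i * (q ^ k i * (q ^ k i * U))
      value-< i@(i₀ , i₁ , i₂ , i₃) = cubic-< (<-≤-trans (digit<U i₀) (U≤q^k i)) (s≤s z≤n)
        (≤-trans (toℕ<n i₁) (≤-trans M₁≤U (U≤q^k i))) (≤-trans 1≤Q (Q≤digit i₂))
        (≤-trans (digit≤U i₂) (U≤q^k i)) (digit<U i₃)

      cube-power : ∀ k w → q ^ k * (q ^ k * (q ^ k * q ^ w)) ≡ q ^ (3 * k + w)
      cube-power k w = trans (cong (λ y → q ^ k * (q ^ k * y)) (sym (^-distribˡ-+-* q k w)))
        (trans (cong (q ^ k *_) (sym (^-distribˡ-+-* q k (k + w))))
        (trans (sym (^-distribˡ-+-* q k (k + (k + w)))) (cong (q ^_) (assoc k w))))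
        where
        assoc : ∀ k w → k + (k + (k + w)) ≡ 3 * k + w
        assoc = solve-∀

      -- The length of the base-q expansion of the value is 3k + v + 1, which determines k.
      k-monotone : ∀ i j → k i < k j → value i < value j
      k-monotone i j ki<kj = begin-strict
        value i                                      <⟨ value-< i ⟩
        q ^ k i * (q ^ k i * (q ^ k i * U))          ≡⟨ cube-power (k i) (suc v) ⟩
        q ^ (3 * k i + suc v)                        ≤⟨ ^-monoʳ-≤ q exponent≤ ⟩
        q ^ (3 * k j + v)                            ≡⟨ sym (cube-power (k j) v) ⟩
        q ^ k j * (q ^ k j * (q ^ k j * Q))          ≤⟨ ≤-cubic (digit (proj₁ j)) (suc (toℕ (proj₁ (proj₂ j))))
                                                          (digit (proj₁ (proj₂ (proj₂ j)))) {x = q ^ k j}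
                                                          (Q≤digit (proj₂ (proj₂ (proj₂ j)))) ⟩
        value j ∎
        where
        open ≤-Reasoning
        exponent≤ : 3 * k i + suc v ≤ 3 * k j + v
        exponent≤ = begin
          3 * k i + suc v       ≡⟨ +-suc (3 * k i) v ⟩
          suc (3 * k i) + v     ≤⟨ +-monoˡ-≤ v (m≤n+m (suc (3 * k i)) 2) ⟩
          3 + 3 * k i + v       ≡⟨ cong (_+ v) (sym (*-suc 3 (k i))) ⟩
          3 * suc (k i) + v     ≤⟨ +-monoˡ-≤ v (*-monoʳ-≤ 3 ki<kj) ⟩
          3 * k j + v ∎

      same-k-injective : ∀ i j K′ → U ≤ q ^ K′ → cubicAt i (q ^ K′) ≡ cubicAt j (q ^ K′) → i ≡ j
      same-k-injective (i₀ , i₁ , i₂ , i₃) (j₀ , j₁ , j₂ , j₃) K′ U≤ eq =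
        cong₂ _,_ (digit-injective (proj₁ parameters≡))
        (cong₂ _,_ (toℕ-injective (suc-injective (proj₁ (proj₂ parameters≡))))
          (cong₂ _,_ (digit-injective (proj₁ (proj₂ (proj₂ parameters≡)))) (digit-injective (proj₂ (proj₂ (proj₂ parameters≡))))))
        where
        parameters≡ = cubic-injective (<-≤-trans (digit<U i₀) U≤) (s≤s z≤n) (≤-trans (toℕ<n i₁) (≤-trans M₁≤U U≤))
          (≤-trans 1≤Q (Q≤digit i₂)) (≤-trans (digit≤U i₂) U≤)
          (<-≤-trans (digit<U j₀) U≤) (s≤s z≤n) (≤-trans (toℕ<n j₁) (≤-trans M₁≤U U≤))
          (≤-trans 1≤Q (Q≤digit j₂)) (≤-trans (digit≤U j₂) U≤) eq

      value-injective : ∀ i j → value i ≡ value j → i ≡ j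
      value-injective i j eq with <-cmp (k i) (k j)
      ... | tri< ki<kj _ _ = contradiction eq (<⇒≢ (k-monotone i j ki<kj))
      ... | tri> _ _ kj<ki = contradiction (sym eq) (<⇒≢ (k-monotone j i kj<ki))
      ... | tri≈ _ ki≡kj _ = same-k-injective i j (k j) (U≤q^k j)
        (trans (cong (λ y → cubicAt i (q ^ y)) (sym ki≡kj)) eq)

      -- The exponent 3k + v + 1 with k ≤ K + m - 1, sorted by v + 1: this is the origin of 3h + 1,
      -- and for r = 0 of q^(3(2h+m)).
      value-bounded : ∀ i → value i < q ^ ((3 * h + 1) * suc v + (6 * h + 3 * m + 3 * r))
      value-bounded i = <-≤-trans (value-< i)
        (≤-trans (≤-reflexive (cube-power (k i) (suc v))) (^-monoʳ-≤ q (begin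
        3 * (K + proj₁ (good-exponent i)) + suc v       ≡⟨ rearrange v h r (proj₁ (good-exponent i)) ⟩
        (3 * h + 1) * suc v + (6 * h + 3 * suc (proj₁ (good-exponent i)) + 3 * r)
          ≤⟨ +-monoʳ-≤ ((3 * h + 1) * suc v) (+-monoˡ-≤ (3 * r) (+-monoʳ-≤ (6 * h)
               (*-monoʳ-≤ 3 (proj₁ (proj₂ (good-exponent i)))))) ⟩
        (3 * h + 1) * suc v + (6 * h + 3 * m + 3 * r) ∎)))
        where
        open ≤-Reasoning
        rearrange : ∀ v h r j → 3 * (suc ((2 + suc v) * h + r) + j) + suc v ≡
                    (3 * h + 1) * suc v + (6 * h + 3 * suc j + 3 * r)
        rearrange = solve-∀

    parameters≤count : ∀ N → q ^ ((3 * h + 1) * suc v + (6 * h + 3 * m + 3 * r)) + e ≤ N →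
                       d * (M₁ * (d * d)) ≤ count q m g f N
    parameters≤count N bound≤N = ≤-count {q} {m} {g} {f} (λ x → value (unpair x) + e)
      (λ {x} {y} eq → unpair-injective (value-injective (unpair x) (unpair y) (+-cancelʳ-≡ e _ _ eq)))
      (λ x → <-≤-trans (+-monoˡ-< e (value-bounded (unpair x))) bound≤N)
      (λ x → subst (λ y → CongMod m (s q y) g) (sym (f-shift (value (unpair x))))
              (proj₂ (proj₂ (good-exponent (unpair x)))))

-- Explicit growth

n≤2d[n/d] : ∀ n d .{{_ : NonZero d}} → d ≤ n → n ≤ 2 * (d * (n / d))
n≤2d[n/d] n d d≤n = begin
  n                               ≡⟨ m≡m%n+[m/n]*n n d ⟩
  n % d + n / d * d               ≤⟨ +-monoˡ-≤ _ (<⇒≤ (m%n<n n d)) ⟩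
  d + n / d * d                   ≤⟨ +-monoˡ-≤ _ (m≤n*m d (n / d) {{>-nonZero (m≥n⇒m/n>0 {n} {d} d≤n)}}) ⟩
  n / d * d + n / d * d           ≡⟨ double (n / d) d ⟩
  2 * (d * (n / d)) ∎
  where
  open ≤-Reasoning
  double : ∀ a d → a * d + a * d ≡ 2 * (d * a)
  double = solve-∀

module _ {q m h : ℕ} (2≤q : 2 ≤ q) (2≤m : 2 ≤ m) (coprime : gcd m (q ∸ 1) ≡ 1) (1≤h : 1 ≤ h)
  (as : Vec ℕ (suc h)) (last≢0 : last as ≢ 0) (f : ℕ → ℕ) (e : ℕ)
  (f-shift : ∀ n → f (n + e) ≡ evalℕ as n) (r : ℕ) (sum≤ : sum as ≤ q ^ r) (S : ℕ)
  (S-large : ∀ u → q ^ ((3 * h + 1) * u + (6 * h + 3 * m + 3 * r)) + e ≤ q ^ ((3 * h + 1) * u + S)) where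

  private
    1≤q = ≤-trans (s≤s z≤n) 2≤q
    D = h * q * (6 * q) ^ h
    1≤D : 1 ≤ D
    1≤D = *-mono-≤ (*-mono-≤ 1≤h 1≤q) (m^n>0 (6 * q) {{m*n≢0 6 q {{_}} {{>-nonZero 1≤q}}}} h)
    instance
      q≢0 : NonZero q
      q≢0 = >-nonZero 1≤q
      D≢0 : NonZero D
      D≢0 = >-nonZero 1≤D

  power-split : ∀ u → q ^ ((3 * h + 1) * u + S) ≡ (q ^ u) ^ (3 * h + 1) * q ^ S
  power-split u = trans (^-distribˡ-+-* q ((3 * h + 1) * u) S)
    (cong (_* q ^ S) (trans (cong (q ^_) (*-comm (3 * h + 1) u)) (sym (^-*-assoc q u (3 * h + 1)))))

  -- Take the largest u with q^((3h+1)u + S) ≤ N. As 2hq²(6q)^h = q · 2D, having q^u ≤ 2D would let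
  -- u + 1 qualify as well.
  large-exponent : ∀ {N} → q ^ S * (2 * h * q ^ 2 * (6 * q) ^ h) ^ (3 * h + 1) ≤ N →
    ∃ λ v → 2 * D < q ^ suc v × q ^ ((3 * h + 1) * suc v + S) ≤ N × N < q ^ ((3 * h + 1) * suc (suc v) + S)
  large-exponent {N} N₀≤N with crossing (λ u → q ^ ((3 * h + 1) * u + S) ≤ N) (λ u → _ ≤? N) start N finish
    where
    base≢0 : NonZero (2 * h * q ^ 2 * (6 * q) ^ h)
    base≢0 = >-nonZero (*-mono-≤ {1} (*-mono-≤ {1} (*-mono-≤ {1} {2} (s≤s z≤n) 1≤h) (m^n>0 q 2))
               (m^n>0 (6 * q) {{m*n≢0 6 q}} h))
    start : q ^ ((3 * h + 1) * 0 + S) ≤ N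
    start = ≤-trans (≤-reflexive (cong (λ y → q ^ (y + S)) (*-zeroʳ (3 * h + 1))))
      (≤-trans (m≤m*n (q ^ S) _ {{m^n≢0 _ (3 * h + 1) {{base≢0}}}}) N₀≤N)
    -- Since N < q^N, the search may stop at u = N.
    finish : ¬ (q ^ ((3 * h + 1) * N + S) ≤ N)
    finish q^≤N = <⇒≱ (n<q^n 2≤q N)
      (≤-trans (^-monoʳ-≤ q (m≤n⇒m≤n+o S (m≤n*m N (3 * h + 1) {{>-nonZero (m≤n+m 1 (3 * h))}}))) q^≤N)
  ... | u , below , above = large u below above
    where
    rearrange : ∀ q h s → q * (2 * (h * q * s)) ≡ 2 * h * (q * (q * 1)) * s
    rearrange = solve-∀
    2D<q^ : ∀ u → ¬ (q ^ ((3 * h + 1) * suc u + S) ≤ N) → 2 * D < q ^ u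
    2D<q^ u above = ≰⇒> λ q^u≤2D → above (begin
      q ^ ((3 * h + 1) * suc u + S)                            ≡⟨ power-split (suc u) ⟩
      (q * q ^ u) ^ (3 * h + 1) * q ^ S
        ≤⟨ *-monoˡ-≤ (q ^ S) (^-monoˡ-≤ (3 * h + 1) (*-monoʳ-≤ q q^u≤2D)) ⟩
      (q * (2 * D)) ^ (3 * h + 1) * q ^ S
        ≡⟨ cong (λ y → y ^ (3 * h + 1) * q ^ S) (rearrange q h ((6 * q) ^ h)) ⟩
      (2 * h * q ^ 2 * (6 * q) ^ h) ^ (3 * h + 1) * q ^ S      ≡⟨ *-comm _ (q ^ S) ⟩
      q ^ S * (2 * h * q ^ 2 * (6 * q) ^ h) ^ (3 * h + 1)      ≤⟨ N₀≤N ⟩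
      N ∎)
      where open ≤-Reasoning
    large : ∀ u → q ^ ((3 * h + 1) * u + S) ≤ N → ¬ (q ^ ((3 * h + 1) * suc u + S) ≤ N) →
            ∃ λ v → 2 * D < q ^ suc v × q ^ ((3 * h + 1) * suc v + S) ≤ N × N < q ^ ((3 * h + 1) * suc (suc v) + S)
    -- u = 0 would give 2D < 1.
    large zero    below above = contradiction (2D<q^ 0 above) (≤⇒≯ (m≤n⇒m≤o*n 2 1≤D))
    large (suc v) below above = v , 2D<q^ (suc v) above , below , ≰⇒> above

  -- With M₁ = U / D, rounding gives U ≤ 2DM₁ and U ≤ 2d, hence (qU)^4 ≤ 16 q^4 D · dM₁d².
  -- Substituting D = hq(6q)^h produces the constant 16hq^5(6q)^h. The power 3h + 1 clears the
  -- fractional exponent.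
  count-growth : ∀ g N → q ^ S * (2 * h * q ^ 2 * (6 * q) ^ h) ^ (3 * h + 1) ≤ N →
    N ^ 4 ≤ (16 * h * q ^ 5 * (6 * q) ^ h * count q m g f N) ^ (3 * h + 1) * q ^ (4 * S)
  count-growth g N N₀≤N = begin
    N ^ 4                                                         ≤⟨ ^-monoˡ-≤ 4 (<⇒≤ N<) ⟩
    (q ^ ((3 * h + 1) * suc (suc v) + S)) ^ 4                     ≡⟨ cong (_^ 4) (power-split (suc (suc v))) ⟩
    ((q ^ suc (suc v)) ^ (3 * h + 1) * q ^ S) ^ 4
      ≡⟨ ^-distribʳ-* 4 ((q ^ suc (suc v)) ^ (3 * h + 1)) (q ^ S) ⟩
    ((q ^ suc (suc v)) ^ (3 * h + 1)) ^ 4 * (q ^ S) ^ 4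
      ≡⟨ cong₂ _*_ (^-swap (q ^ suc (suc v)) (3 * h + 1) 4)
                                                                       (trans (^-*-assoc q S 4) (cong (q ^_) (*-comm S 4))) ⟩
    ((q ^ suc (suc v)) ^ 4) ^ (3 * h + 1) * q ^ (4 * S)
      ≤⟨ *-monoˡ-≤ (q ^ (4 * S)) (^-monoˡ-≤ (3 * h + 1) fourth-power≤) ⟩
    (16 * h * q ^ 5 * (6 * q) ^ h * c) ^ (3 * h + 1) * q ^ (4 * S) ∎
    where
    open ≤-Reasoning
    exponent = large-exponent N₀≤N
    v = proj₁ exponent
    2D<U = proj₁ (proj₂ exponent)
    ≤N = proj₁ (proj₂ (proj₂ exponent))
    N< = proj₂ (proj₂ (proj₂ exponent))
    U = q ^ suc v
    M₁ = U / D
    d = (q ∸ 1) * q ^ v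
    c = count q m g f N
    open Counting 2≤q 2≤m coprime 1≤h as last≢0 f e f-shift r sum≤
    parameters≤c : d * (M₁ * (d * d)) ≤ c
    parameters≤c = parameters≤count v M₁ (≤-trans (≤-reflexive (*-comm D M₁)) (m/n*n≤m U D)) g N
      (≤-trans (S-large (suc v)) ≤N)
    ^-swap : ∀ x a b → (x ^ a) ^ b ≡ (x ^ b) ^ a
    ^-swap x a b = trans (^-*-assoc x a b) (trans (cong (x ^_) (*-comm a b)) (sym (^-*-assoc x b a)))
    U≤2M₁ : U ≤ 2 * (D * M₁)
    U≤2M₁ = n≤2d[n/d] U D (≤-trans (m≤n*m D 2) (<⇒≤ 2D<U))
    U≤2d : U ≤ 2 * d
    U≤2d = begin
      q * q ^ v              ≡⟨ cong (_* q ^ v) (sym (m+[n∸m]≡n 1≤q)) ⟩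
      q ^ v + d              ≤⟨ +-monoˡ-≤ d (m≤n*m (q ^ v) (q ∸ 1) {{>-nonZero (m<n⇒0<n∸m 2≤q)}}) ⟩
      d + d                  ≡⟨ cong (λ z → d + z) (sym (+-identityʳ d)) ⟩
      2 * d ∎
    pull-q : ∀ q U → (q * U) * ((q * U) * ((q * U) * ((q * U) * 1))) ≡ q * (q * (q * q)) * (U * (U * (U * U)))
    pull-q = solve-∀
    pull-2 : ∀ d D M → 2 * d * (2 * d * (2 * d * (2 * (D * M)))) ≡ 16 * D * (d * (M * (d * d)))
    pull-2 = solve-∀
    collect : ∀ q h s c → q * (q * (q * q)) * (16 * (h * q * s) * c) ≡ 16 * h * (q * (q * (q * (q * (q * 1))))) * s * c
    collect = solve-∀
    fourth-power≤ : (q ^ suc (suc v)) ^ 4 ≤ 16 * h * q ^ 5 * (6 * q) ^ h * c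
    fourth-power≤ = begin
      (q * U) ^ 4                                        ≡⟨ pull-q q U ⟩
      q * (q * (q * q)) * (U * (U * (U * U)))
        ≤⟨ *-monoʳ-≤ (q * (q * (q * q))) (*-mono-≤ U≤2d (*-mono-≤ U≤2d (*-mono-≤ U≤2d U≤2M₁))) ⟩
      q * (q * (q * q)) * (2 * d * (2 * d * (2 * d * (2 * (D * M₁)))))
        ≡⟨ cong (q * (q * (q * q)) *_) (pull-2 d D M₁) ⟩
      q * (q * (q * q)) * (16 * D * (d * (M₁ * (d * d))))
        ≤⟨ *-monoʳ-≤ (q * (q * (q * q))) (*-monoʳ-≤ (16 * D) parameters≤c) ⟩
      q * (q * (q * q)) * (16 * D * c)                   ≡⟨ collect q h ((6 * q) ^ h) c ⟩
      16 * h * q ^ 5 * (6 * q) ^ h * c ∎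

-- Polynomials

-- One Horner step of a Taylor shift; the argument `a` carries the coefficient that the factor x
-- moves up from the place below.
mulLinear : ∀ {n} → ℕ → ℕ → Vec ℕ n → Vec ℕ (suc n)
mulLinear a d []       = a ∷ []
mulLinear a d (b ∷ bs) = (a + d * b) ∷ mulLinear b d bs

evalℕ-mulLinear : ∀ {n} a d (bs : Vec ℕ n) x → evalℕ (mulLinear a d bs) x ≡ a + (x + d) * evalℕ bs x
evalℕ-mulLinear a d []       x = cong (λ z → a + z) (trans (*-zeroʳ x) (sym (*-zeroʳ (x + d))))
evalℕ-mulLinear a d (b ∷ bs) x =
  trans (cong (λ y → a + d * b + x * y) (evalℕ-mulLinear b d bs x)) (collect a b d x (evalℕ bs x))
  where
  collect : ∀ a b d x B → a + d * b + x * (b + (x + d) * B) ≡ a + (x + d) * (b + x * B)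
  collect = solve-∀

mulLinear-positive : ∀ {n a} d {bs : Vec ℕ n} → 1 ≤ a → All (1 ≤_) bs → All (1 ≤_) (mulLinear a d bs)
mulLinear-positive d 1≤a []           = 1≤a ∷ []
mulLinear-positive {a = a} d 1≤a (1≤b ∷ 1≤bs) = m≤n⇒m≤n+o _ 1≤a ∷ mulLinear-positive d 1≤b 1≤bs

translate : ∀ {n} → ℕ → Vec ℕ n → Vec ℕ n
translate d []       = []
translate d (a ∷ as) = mulLinear a d (translate d as)

evalℕ-translate : ∀ {n} d (as : Vec ℕ n) x → evalℕ (translate d as) x ≡ evalℕ as (x + d)
evalℕ-translate d []       x = refl
evalℕ-translate d (a ∷ as) x =
  trans (evalℕ-mulLinear a d (translate d as) x) (cong (λ y → a + (x + d) * y) (evalℕ-translate d as x))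

translate-positive : ∀ {n} d {as : Vec ℕ n} → All (1 ≤_) as → All (1 ≤_) (translate d as)
translate-positive d []           = []
translate-positive d (1≤a ∷ 1≤as) = mulLinear-positive d 1≤a (translate-positive d 1≤as)

last-positive : ∀ {n} {as : Vec ℕ (suc n)} → All (1 ≤_) as → last as ≢ 0
last-positive {as = a ∷ []}    (1≤a ∷ [])    = m<n⇒n≢0 1≤a
last-positive {as = a ∷ b ∷ _} (_ ∷ positive) = last-positive positive

ℤ-offset : ∀ a y → ∣ a ∣ < y → ∃ λ c → 1 ≤ c × a ℤ.+ + y ≡ + c
ℤ-offset (+ k)        y ∣a∣<y = k + y , m≤n⇒m≤o+n k (≤-trans (s≤s z≤n) ∣a∣<y) , refl
ℤ-offset ℤ.-[1+ k ]   y ∣a∣<y = y ∸ suc k , m<n⇒0<n∸m ∣a∣<y , ℤ.⊖-≥ (<⇒≤ ∣a∣<y)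

-- For p = a + x p₁, first make p₁ positive, then translate further: this preserves positivity, and
-- the new constant term a + (d + e)b is positive as well.
positive-translate : ∀ {n} (p : Vec ℤ (suc n)) → + 0 ℤ.< last p →
  ∃₂ λ e (bs : Vec ℕ (suc n)) → All (1 ≤_) bs × (∀ x → evalPoly p (+ (x + e)) ≡ + evalℕ bs x)
positive-translate (+ c ∷ []) (ℤ.+<+ 1≤c) = 0 , c ∷ [] , 1≤c ∷ [] , λ x →
  trans (cong (λ y → + c ℤ.+ y) (ℤ.*-zeroʳ (+ (x + 0)))) (cong (λ y → + (c + y)) (sym (*-zeroʳ x)))
positive-translate (a ∷ p@(_ ∷ _)) last>0 with positive-translate p last>0
... | e , bs , 1≤bs , p≡
  with translate (suc ∣ a ∣) bs | translate-positive (suc ∣ a ∣) 1≤bs | evalℕ-translate (suc ∣ a ∣) bs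
... | b ∷ bs′ | 1≤b ∷ 1≤bs′ | bs≡
  -- As b ≥ 1, the choice d = |a| + 1 makes (d + e)b exceed |a|.
  with ℤ-offset a ((suc ∣ a ∣ + e) * b)
         (≤-trans (m≤m+n (suc ∣ a ∣) e) (m≤m*n _ b {{>-nonZero 1≤b}}))
... | c , 1≤c , c≡ = d + e , c ∷ mulLinear b (d + e) bs′ , 1≤c ∷ mulLinear-positive (d + e) 1≤b 1≤bs′ , λ x → begin
    a ℤ.+ + (x + (d + e)) ℤ.* evalPoly p (+ (x + (d + e)))
      ≡⟨ cong (λ y → a ℤ.+ + (x + (d + e)) ℤ.* y)
           (trans (cong (λ y → evalPoly p (+ y)) (sym (+-assoc x d e))) (trans (p≡ (x + d)) (cong +_ (sym (bs≡ x))))) ⟩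
    a ℤ.+ + (x + (d + e)) ℤ.* + (b + x * evalℕ bs′ x)
      ≡⟨ cong (λ y → a ℤ.+ y) (sym (ℤ.pos-* (x + (d + e)) _)) ⟩
    a ℤ.+ + ((x + (d + e)) * (b + x * evalℕ bs′ x))
      ≡⟨ cong (λ y → a ℤ.+ + y) (separate x (d + e) b (evalℕ bs′ x)) ⟩
    a ℤ.+ (+ ((d + e) * b) ℤ.+ + (x * (b + (x + (d + e)) * evalℕ bs′ x)))
      ≡⟨ sym (ℤ.+-assoc a (+ ((d + e) * b)) _) ⟩
    a ℤ.+ + ((d + e) * b) ℤ.+ + (x * (b + (x + (d + e)) * evalℕ bs′ x))
      ≡⟨ cong₂ (λ y z → y ℤ.+ + (x * z)) c≡ (sym (evalℕ-mulLinear b (d + e) bs′ x)) ⟩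
    + (c + x * evalℕ (mulLinear b (d + e) bs′) x) ∎
  where
  open ≡-Reasoning
  d = suc ∣ a ∣
  separate : ∀ x e b B → (x + e) * (b + x * B) ≡ e * b + x * (b + (x + e) * B)
  separate = solve-∀

last-negate : ∀ {n} (p : Vec ℤ (suc n)) → last (map ℤ.-_ p) ≡ ℤ.- last p
last-negate (a ∷ [])    = refl
last-negate (a ∷ b ∷ p) = last-negate (b ∷ p)

evalPoly-negate : ∀ {n} (p : Vec ℤ n) x → evalPoly (map ℤ.-_ p) x ≡ ℤ.- evalPoly p x
evalPoly-negate []      x = refl
evalPoly-negate (a ∷ p) x =
  trans (cong (λ y → ℤ.- a ℤ.+ x ℤ.* y) (evalPoly-negate p x)) (pull a x (evalPoly p x))
  where
  pull : ∀ a x y → ℤ.- a ℤ.+ x ℤ.* (ℤ.- y) ≡ ℤ.- (a ℤ.+ x ℤ.* y)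
  pull = ℤ-Solver.solve-∀

-- Were the leading coefficient negative, -p would have a positive translate and p(e) < 0.
nonnegative⇒last>0 : ∀ {n} (p : Vec ℤ (suc n)) → last p ≢ + 0 → (∀ n → + 0 ≤ℤ evalPoly p (+ n)) → + 0 ℤ.< last p
nonnegative⇒last>0 p last≢0 p≥0 with ℤ.<-cmp (+ 0) (last p)
... | tri< last>0 _ _ = last>0
... | tri≈ _ last≡0 _ = contradiction (sym last≡0) last≢0
... | tri> _ _ last<0
  with positive-translate (map ℤ.-_ p) (subst (+ 0 ℤ.<_) (sym (last-negate p)) (ℤ.neg-mono-< last<0))
...   | e , b ∷ bs , 1≤b ∷ _ , -p≡ = contradiction
        (ℤ.≤-trans (ℤ.+≤+ (m≤n⇒m≤n+o _ 1≤b))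
          (subst (_≤ℤ + 0) (trans (sym (evalPoly-negate p (+ e))) (-p≡ 0)) (ℤ.neg-mono-≤ (p≥0 e))))
        λ { (ℤ.+≤+ ()) }

-- Final bounds for monomials and general polynomials

monomial : ∀ h → Vec ℕ (suc h)
monomial zero    = 1 ∷ []
monomial (suc h) = 0 ∷ monomial h

evalℕ-monomial : ∀ h x → evalℕ (monomial h) x ≡ x ^ h
evalℕ-monomial zero    x = cong suc (*-zeroʳ x)
evalℕ-monomial (suc h) x = cong (x *_) (evalℕ-monomial h x)

sum-monomial : ∀ h → sum (monomial h) ≡ 1
sum-monomial zero    = refl
sum-monomial (suc h) = sum-monomial h

last-monomial : ∀ h → last (monomial h) ≡ 1
last-monomial zero          = refl
last-monomial (suc zero)    = refl
last-monomial (suc (suc h)) = last-monomial (suc h)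

module _ {q m : ℕ} (2≤q : 2 ≤ q) (2≤m : 2 ≤ m) (coprime : gcd m (q ∸ 1) ≡ 1) where
  private
    1≤q = ≤-trans (s≤s z≤n) 2≤q
    instance
      q≢0 : NonZero q
      q≢0 = >-nonZero 1≤q

  monomial-count : ∀ h → 1 ≤ h → ∀ g N →
    q ^ (3 * (2 * h + m)) * (2 * h * q ^ 2 * (6 * q) ^ h) ^ (3 * h + 1) ≤ N →
    N ^ 4 ≤ (16 * h * q ^ 5 * (6 * q) ^ h * count q m g (λ n → n ^ h) N) ^ (3 * h + 1) * q ^ (24 * h + 12 * m)
  monomial-count h 1≤h g N N₀≤N = subst
    (λ y → N ^ 4 ≤ (16 * h * q ^ 5 * (6 * q) ^ h * count q m g (λ n → n ^ h) N) ^ (3 * h + 1) * q ^ y)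
    (exponent h m)
    (count-growth 2≤q 2≤m coprime 1≤h (monomial h) (λ eq → 1+n≢0 (trans (sym (last-monomial h)) eq)) (_^ h) 0
      (λ n → trans (cong (_^ h) (+-identityʳ n)) (sym (evalℕ-monomial h n))) 0 (≤-reflexive (sum-monomial h)) (3 * (2 * h + m))
      (λ u → ≤-reflexive (trans (+-identityʳ _) (cong (λ y → q ^ ((3 * h + 1) * u + y)) (regroup h m)))) g N N₀≤N)
    where
    exponent : ∀ h m → 4 * (3 * (2 * h + m)) ≡ 24 * h + 12 * m
    exponent = solve-∀
    regroup : ∀ h m → 6 * h + 3 * m + 0 ≡ 3 * (2 * h + m)
    regroup = solve-∀

  polynomial-count : ∀ h → 1 ≤ h → (p : Vec ℤ (suc h)) → last p ≢ + 0 → (∀ n → + 0 ≤ℤ evalPoly p (+ n)) →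
    ∃₂ λ b N₀ → 1 ≤ b × 1 ≤ N₀ × (∀ g N → N₀ ≤ N →
      N ^ 4 ≤ (b * count q m g (λ n → ∣ evalPoly p (+ n) ∣) N) ^ (3 * h + 1))
  polynomial-count h 1≤h p last≢0 p≥0 with positive-translate p (nonnegative⇒last>0 p last≢0 p≥0)
  ... | e , as , 1≤as , p≡ = B * q ^ (4 * S) , N₀ , *-mono-≤ 1≤B (m^n>0 q (4 * S)) , *-mono-≤ (m^n>0 q S) 1≤W , bound
    where
    r S B N₀ : ℕ
    -- From r < q^r both the coefficient sum and e are bounded by q^r; the extra 1 in S absorbs the
    -- shift by e, since q^E + e ≤ 2q^E ≤ q^(E+1).
    r = sum as + e
    S = suc (6 * h + 3 * m + 3 * r)
    B = 16 * h * q ^ 5 * (6 * q) ^ h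
    N₀ = q ^ S * (2 * h * q ^ 2 * (6 * q) ^ h) ^ (3 * h + 1)
    1≤6q^h : 1 ≤ (6 * q) ^ h
    1≤6q^h = m^n>0 (6 * q) {{m*n≢0 6 q}} h
    1≤B : 1 ≤ B
    1≤B = *-mono-≤ (*-mono-≤ (*-mono-≤ {1} {16} (s≤s z≤n) 1≤h) (m^n>0 q 5)) 1≤6q^h
    1≤W : 1 ≤ (2 * h * q ^ 2 * (6 * q) ^ h) ^ (3 * h + 1)
    1≤W = m^n>0 _ {{>-nonZero (*-mono-≤ (*-mono-≤ (*-mono-≤ {1} {2} (s≤s z≤n) 1≤h) (m^n>0 q 2)) 1≤6q^h)}} (3 * h + 1)
    r≤q^r : r ≤ q ^ r
    r≤q^r = <⇒≤ (n<q^n 2≤q r)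
    S-large : ∀ u → q ^ ((3 * h + 1) * u + (6 * h + 3 * m + 3 * r)) + e ≤ q ^ ((3 * h + 1) * u + S)
    S-large u = begin
      q ^ E + e          ≤⟨ +-monoʳ-≤ (q ^ E) (≤-trans (m≤n+m e (sum as)) (≤-trans r≤q^r (^-monoʳ-≤ q r≤E))) ⟩
      q ^ E + q ^ E      ≡⟨ cong (λ z → q ^ E + z) (sym (+-identityʳ (q ^ E))) ⟩
      2 * q ^ E          ≤⟨ *-monoˡ-≤ (q ^ E) 2≤q ⟩
      q ^ suc E          ≡⟨ cong (q ^_) (sym (+-suc ((3 * h + 1) * u) _)) ⟩
      q ^ ((3 * h + 1) * u + S) ∎
      where
      open ≤-Reasoning
      E = (3 * h + 1) * u + (6 * h + 3 * m + 3 * r)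
      r≤E : r ≤ E
      r≤E = m≤n⇒m≤o+n ((3 * h + 1) * u) (m≤n⇒m≤o+n (6 * h + 3 * m) (m≤n*m r 3))
    bound : ∀ g N → N₀ ≤ N → N ^ 4 ≤ (B * q ^ (4 * S) * count q m g (λ n → ∣ evalPoly p (+ n) ∣) N) ^ (3 * h + 1)
    bound g N N₀≤N = begin
      N ^ 4                                            ≤⟨ count-growth 2≤q 2≤m coprime 1≤h as (last-positive 1≤as)
                                                            (λ n → ∣ evalPoly p (+ n) ∣) e (λ n → cong ∣_∣ (p≡ n)) r
                                                            (≤-trans (m≤m+n (sum as) e) r≤q^r) S S-large g N N₀≤N ⟩
      -- As Y ≥ 1, raising it to the power 3h + 1 lets it join the constant b.
      (B * c) ^ (3 * h + 1) * Y                        ≤⟨ *-monoʳ-≤ ((B * c) ^ (3 * h + 1)) Y≤Y^ ⟩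
      (B * c) ^ (3 * h + 1) * Y ^ (3 * h + 1)          ≡⟨ sym (^-distribʳ-* (3 * h + 1) (B * c) Y) ⟩
      (B * c * Y) ^ (3 * h + 1)                        ≡⟨ cong (_^ (3 * h + 1)) (swap B c Y) ⟩
      (B * Y * c) ^ (3 * h + 1) ∎
      where
      open ≤-Reasoning
      c = count q m g (λ n → ∣ evalPoly p (+ n) ∣) N
      Y = q ^ (4 * S)
      Y≤Y^ : Y ≤ Y ^ (3 * h + 1)
      Y≤Y^ = ≤-trans (≤-reflexive (sym (*-identityʳ Y))) (^-monoʳ-≤ Y {{m^n≢0 q (4 * S)}} (m≤n+m 1 (3 * h)))
      swap : ∀ a b c → a * b * c ≡ a * c * b
      swap = solve-∀

theorem1p4 : (q m : ℕ) → 2 ≤ q → 2 ≤ m → gcd m (q ∸ 1) ≡ 1 →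
    ((h : ℕ) → 3 ≤ h → (p : Vec ℤ (suc h)) → last p ≢ + 0 →
    ((n : ℕ) → + 0 ≤ℤ evalPoly p (+ n)) →
    Σ ℕ λ a → Σ ℕ λ b → Σ ℕ λ N₀ → 1 ≤ a × 1 ≤ b × 1 ≤ N₀ ×
    ((g : ℤ) (N : ℕ) → N₀ ≤ N →
    a ^ (3 * h + 1) * N ^ 4
    ≤ (b * count q m g (λ n → ∣ evalPoly p (+ n) ∣) N) ^ (3 * h + 1)))
    ×
    ((h : ℕ) → 3 ≤ h → (g : ℤ) (N : ℕ) →
    q ^ (3 * (2 * h + m)) * (2 * h * q ^ 2 * (6 * q) ^ h) ^ (3 * h + 1) ≤ N →
    N ^ 4 ≤ (16 * h * q ^ 5 * (6 * q) ^ h * count q m g (λ n → n ^ h) N) ^ (3 * h + 1)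
    * q ^ (24 * h + 12 * m))
theorem1p4 q m 2≤q 2≤m coprime = polynomial , monomials
  where
  3≤⇒1≤ : ∀ {h} → 3 ≤ h → 1 ≤ h
  3≤⇒1≤ = ≤-trans (s≤s z≤n)
  polynomial = λ h 3≤h p last≢0 p≥0 →
    let (b , N₀ , 1≤b , 1≤N₀ , bound) = polynomial-count 2≤q 2≤m coprime h (3≤⇒1≤ 3≤h) p last≢0 p≥0 in
    -- The constant C is a / b, here 1 / b.
    1 , b , N₀ , s≤s z≤n , 1≤b , 1≤N₀ , λ g N N₀≤N →
    ≤-trans (≤-reflexive (trans (cong (_* N ^ 4) (^-zeroˡ (3 * h + 1))) (*-identityˡ (N ^ 4)))) (bound g N N₀≤N)
  monomials = λ h 3≤h → monomial-count 2≤q 2≤m coprime h (3≤⇒1≤ 3≤h)
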